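{- Let $n\ge1$. The map $\omega\circ\psi\colon V_n\to V_n$ is an involution, and for every $\pi\in V_n$ one has $s_{\omega(\psi(\pi))}=a_\pi$ and $a_{\omega(\psi(\pi))}=s_\pi$.
   Context: Let $[\pm n]=\{\pm1,\ldots,\pm n\}$. A partition of type $B_n$ is a set partition of $[\pm n]$ such that for every block $B$, $-B=\{ -b:b\in B\}$ is a block, with at most one block satisfying $B=-B$ (the zero-block); $V_n$ is the set of such partitions without zero-block. More generally, let $S=\{\pm t_1,\ldots,\pm t_r\}$ with $0<t_1<\cdots<t_r$; a symmetric partition of $S$ is a partition of $S$ such that $-B$ is a block whenever $B$ is (the empty partition of $S=\emptyset$ is allowed). For such $\pi$: $\pm t_i$ is a singleton pair if $\{t_i\}$ is a block; $\pm(t_j,t_{j+1})$ is an adjacency pair if $t_j,t_{j+1}$ lie in the same block, indices taken cyclically ($t_{r+1}=t_1$); in that case $\pm t_j$ is called a left-point-pair. (If $r=1$, $\{\{t_1\},\{ -t_1\}\}$ has one singleton pair and one adjacency pair $\pm(t_1,t_1)$, so $\pm t_1$ is also a left-point-pair.) For $\pi\in V_n$ (i.e. $S=[\pm n]$, $t_i=i$), $s_\pi$ and $a_\pi$ are its numbers of singleton pairs and adjacency pairs. Peeling. Given $\pi\in V_n$, set $\pi_0=\pi$. For $i\ge1$, as long as $\pi_{i-1}$ has a singleton pair or an adjacency pair, let $S_i$ be the set of elements $\pm t$ forming singleton pairs of $\pi_{i-1}$, $L_i$ the set of elements $\pm t$ forming left-point-pairs of $\pi_{i-1}$, and let $\pi_i$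 be the symmetric partition obtained from $\pi_{i-1}$ by deleting all elements of $S_i\cup L_i$ (and discarding empty blocks). Stop at the first $k$ such that $\pi_k$ has neither singleton pairs nor adjacency pairs ($\pi_k$ may be empty). Patching. Set $\sigma_k=\pi_k$. For $i=k,k-1,\ldots,1$, construct a symmetric partition $\sigma_{i-1}$ of the underlying set $\{\pm t_1,\ldots,\pm t_r\}$ ($0<t_1<\cdots<t_r$) of $\pi_{i-1}$ as follows. If $\sigma_i$ is empty: if $\pi_{i-1}$ consists of a single pair of blocks $\pm B$, let $\sigma_{i-1}=\{\pm\{t_1\},\ldots,\pm\{t_r\}\}$; otherwise let $\sigma_{i-1}=\{\pm\{t_1,\ldots,t_r\}\}$. If $\sigma_i$ is nonempty: decompose the positive elements of $S_i$ into maximal runs of cyclically consecutive elements $\{t_{j+1},t_{j+2},\ldots,t_{j+h}\}$ (indices mod $r$) of the list $t_1,\ldots,t_r$; for each run, $t_j$ is an element of $\sigma_i$, and one adds $t_{j+1},\ldots,t_{j+h}$ to the block of $\sigma_i$ containing $t_j$ and $-t_{j+1},\ldots,-t_{j+h}$ to the block containing $-t_j$; finally, for each positive $t$ with $\pm t\in L_i$, add the blocks $\{t\}$ and $\{ -t\}$. The result is $\sigma_{i-1}$. Define $\psi(\pi)=\sigma_0$. Complement. For $i\in[n]$ define $\omega(i)=n+1-i$ and $\omega(-i)=-(n+1-i)$; for $\pi\in V_n$, $\omega(\pi)$ is the partition obtained by applying $\omega$ to every element of every block. -}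

module Defs where

open import Data.Bool using (Bool; true; false; _∧_; _∨_; not; if_then_else_)
open import Data.Nat as ℕ using (ℕ; zero; suc; _≤_; _∸_)
open import Data.Integer as ℤ using (ℤ; +_; -[1+_]; -_; ∣_∣)
open import Data.List using (List; []; _∷_; [_]; map; length; _++_; concatMap;
  null; upTo; zip; reverse; takeWhileᵇ; dropWhileᵇ; drop; filterᵇ; foldr)
open import Data.Bool.ListAction using (any; all)
open import Data.Maybe using (Maybe; just; nothing)
open import Data.Product using (Σ; ∃; _×_; _,_; proj₁)
open import Relation.Binary.PropositionalEquality using (_≡_; _≢_)
open import Relation.Nullary using (¬_)
open import Relation.Nullary.Decidable using (⌊_⌋)
open import Data.List.Membership.Propositional using (_∈_)

-- Conventions.
-- Elements of [±n] are nonzero integers.  A block is a finite list of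
-- integers (read as the set of its entries); a partition is a list of
-- blocks (read as the set of its blocks).  Equality of partitions is
-- equality as sets of sets ('PartEq').
-- An underlying set S = {±t₁,…,±t_r} is given by the increasing list
-- t₁,…,t_r of its positive elements.

Block : Set
Block = List ℤ

Partition : Set
Partition = List Block

_==ℤ_ : ℤ → ℤ → Bool
x ==ℤ y = ⌊ x ℤ.≟ y ⌋

_==ℕ_ : ℕ → ℕ → Bool
x ==ℕ y = ⌊ x ℕ.≟ y ⌋

elemℤ : ℤ → List ℤ → Bool
elemℤ x B = any (x ==ℤ_) B

elemℕ : ℕ → List ℕ → Bool
elemℕ x D = any (x ==ℕ_) D

sameBlock : Partition → ℤ → ℤ → Bool
sameBlock P x y = any (λ B → elemℤ x B ∧ elemℤ y B) P

singletonBlock : Partition → ℤ → Bool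
singletonBlock P x = any (λ B → elemℤ x B ∧ all (_==ℤ x) B) P

rotate : List ℕ → List ℕ
rotate []       = []
rotate (x ∷ xs) = xs ++ [ x ]

singletonPairs : List ℕ → Partition → List ℕ
singletonPairs S P = filterᵇ (λ t → singletonBlock P (+ t)) S

adjacencyPairs : List ℕ → Partition → List (ℕ × ℕ)
adjacencyPairs S P = filterᵇ (λ { (t , t') → sameBlock P (+ t) (+ t') }) (zip S (rotate S))

leftPointPairs : List ℕ → Partition → List ℕ
leftPointPairs S P = map proj₁ (adjacencyPairs S P)

deleteSet : List ℕ → List ℕ → List ℕ
deleteSet D S = filterᵇ (λ t → not (elemℕ t D)) S

deletePart : List ℕ → Partition → Partition
deletePart D P = filterᵇ (λ B → not (null B))
                   (map (filterᵇ (λ x → not (elemℕ ∣ x ∣ D))) P)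

cycPred : List ℕ → List ℕ → ℕ → Maybe ℕ
cycPred S D t = firstOut (reverse before ++ reverse after)
  where
  before = takeWhileᵇ (λ u → not (u ==ℕ t)) S
  after  = drop 1 (dropWhileᵇ (λ u → not (u ==ℕ t)) S)
  firstOut : List ℕ → Maybe ℕ
  firstOut []       = nothing
  firstOut (u ∷ us) = if elemℕ u D then firstOut us else just u

addTo : ℤ → ℤ → Partition → Partition
addTo p x P = map (λ B → if elemℤ p B then B ++ [ x ] else B) P

-- add t (resp. -t) to the block of σ containing p (resp. -p),
-- where p is the element t_j preceding the run of t
attach : List ℕ → List ℕ → ℕ → Partition → Partition
attach S D t σ with cycPred S D t
... | nothing = σ
... | just p  = addTo (- (+ p)) (- (+ t)) (addTo (+ p) (+ t) σ)

pairOfSingletons : ℕ → Partition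
pairOfSingletons t = [ + t ] ∷ [ - (+ t) ] ∷ []

-- One patching step: from σ_i build σ_{i-1}, given the underlying set S
-- and the partition π_{i-1}, the sets S_i, L_i, and the underlying set S'
-- of π_i (= of σ_i).
patch : List ℕ → Partition → List ℕ → List ℕ → List ℕ → Partition → Partition
patch S P Si Li S' σ =
  if null S'
  then (if length P ==ℕ 2
        then concatMap pairOfSingletons S
        else map +_ S ∷ map (λ t → - (+ t)) S ∷ [])
  else foldr (attach S Si) σ Si ++ concatMap pairOfSingletons Li

-- Peeling followed by patching.  The fuel argument only ensures
-- termination: each peeling step removes at least one pair, so fuel
-- 1 + |S| is always sufficient.
psiAux : ℕ → List ℕ → Partition → Partition
psiAux zero    S P = P
psiAux (suc f) S P =
  if null Si ∧ null Li then P
  else patch S P Si Li S' (psiAux f S' P')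
  where
  Si = singletonPairs S P
  Li = leftPointPairs S P
  S' = deleteSet (Si ++ Li) S
  P' = deletePart (Si ++ Li) P

posRange : ℕ → List ℕ
posRange n = map suc (upTo n)

ψ : ℕ → Partition → Partition
ψ n P = psiAux (suc n) (posRange n) P

ωElem : ℕ → ℤ → ℤ
ωElem n (+ k)      = + (suc n ∸ k)
ωElem n -[1+ k ]   = - (+ (suc n ∸ suc k))

ω : ℕ → Partition → Partition
ω n P = map (map (ωElem n)) P

sCount : ℕ → Partition → ℕ
sCount n P = length (singletonPairs (posRange n) P)

aCount : ℕ → Partition → ℕ
aCount n P = length (adjacencyPairs (posRange n) P)

BlockEq : Block → Block → Set
BlockEq B C = (∀ x → x ∈ B → x ∈ C) × (∀ x → x ∈ C → x ∈ B)

PartEq : Partition → Partition → Set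
PartEq P Q = (∀ B → B ∈ P → Σ Block λ C → C ∈ Q × BlockEq B C)
           × (∀ C → C ∈ Q → Σ Block λ B → B ∈ P × BlockEq B C)

negBlock : Block → Block
negBlock B = map -_ B

InRange : ℕ → ℤ → Set
InRange n x = (x ≢ + 0) × (∣ x ∣ ≤ n)

record IsV (n : ℕ) (P : Partition) : Set where
  field
    nonempty  : ∀ B → B ∈ P → B ≢ []
    inRange   : ∀ B x → B ∈ P → x ∈ B → InRange n x
    covers    : ∀ x → InRange n x → length (filterᵇ (elemℤ x) P) ≡ 1
    symmetric : ∀ B → B ∈ P → Σ Block λ C → C ∈ P × BlockEq C (negBlock B)
    noZero    : ∀ B → B ∈ P → ¬ BlockEq B (negBlock B)

{-# OPTIONS --safe #-}
-- The map ψ only depends on the relation of lying in a common block and on the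
-- cyclic successor relation of the underlying set.  One patching step is
-- determined by three conditions: σ_{i-1} restricts to σ_i, every left point of
-- π_{i-1} becomes a singleton, and every singleton of π_{i-1} joins the block of
-- its cyclic predecessor.  By induction on the layers, the singletons of σ_{i-1}
-- are exactly the left points of π_{i-1}, and its right points (the left points
-- for the reversed order) are exactly the singletons of π_{i-1}.  So σ_{i-1}
-- peels, in the reversed order, to σ_i, and π_{i-1} meets the three conditions
-- for patching it back: the graph of ψ is symmetric up to reversal of the cyclic
-- order.  Since ω reverses that order, ω ∘ ψ is an involution, and it exchanges
-- singleton pairs with adjacency pairs.
module Submission where

open import Defs
open import Data.Bool using (Bool; true; false; T; not; if_then_else_; _∧_)
open import Data.Bool.ListAction using (any; all)
open import Data.Bool.Properties using (T-∧)
open import Data.Empty using (⊥; ⊥-elim)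
open import Data.Integer using (ℤ; +_; -[1+_]; -_; ∣_∣)
open import Data.Integer.Properties using (+-injective; neg-involutive; ∣-i∣≡∣i∣; ∣i∣≡0⇒i≡0)
open import Data.List using (List; []; _∷_; _++_; map; length; concatMap; null; upTo; downFrom;
  applyUpTo; applyDownFrom; zip; reverse; takeWhileᵇ; dropWhileᵇ; drop; filterᵇ; foldr)
open import Data.List.Membership.Propositional using (_∈_; _∉_; find; lose)
open import Data.List.Membership.Propositional.Properties using (∈-++⁺ˡ; ∈-++⁺ʳ; ∈-++⁻; ∈-∃++;
  ∈-map⁺; ∈-map⁻; ∈-filter⁺; ∈-filter⁻; ∈-upTo⁺; ∈-upTo⁻)
open import Data.List.Membership.Propositional.Properties.WithK using (unique∧set⇒bag)
open import Data.List.Properties using (++-assoc; ++-identityʳ; filter-++; filter-accept; filter-reject;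
  filter-none; filter-notAll; length-map; length-upTo; map-∘; map-cong-local; map-upTo; map-downFrom;
  reverse-++; reverse-involutive; reverse-map; reverse-upTo; unfold-reverse)
open import Data.List.Relation.Binary.BagAndSetEquality using (∼bag⇒↭)
open import Data.List.Relation.Binary.Disjoint.Propositional using (Disjoint)
open import Data.List.Relation.Binary.Permutation.Propositional.Properties using (↭-length)
open import Data.List.Relation.Binary.Pointwise using (Pointwise; []; _∷_)
open import Data.List.Relation.Unary.All as All using (All; []; _∷_)
open import Data.List.Relation.Unary.All.Properties as All using (all⁺; all⁻; all-upTo)
open import Data.List.Relation.Unary.AllPairs as AllPairs using (AllPairs; []; _∷_)
open import Data.List.Relation.Unary.AllPairs.Properties as AllPairs using ()
open import Data.List.Relation.Unary.Any as Any using (here; there)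
open import Data.List.Relation.Unary.Any.Properties as Any using (any⁺; any⁻)
open import Data.List.Relation.Unary.Unique.Propositional using (Unique)
open import Data.List.Relation.Unary.Unique.Propositional.Properties as Unique using ()
open import Data.Maybe using (Maybe; just)
open import Data.Maybe.Properties using (just-injective)
open import Data.Nat using (ℕ; zero; suc; _∸_; _≤_; _<_; s≤s; _≟_; _<?_)
open import Data.Nat.Properties using (suc-injective; ≤-refl; ≤-reflexive; ≤-trans; n≤1+n; m∸n≤m;
  m∸[m∸n]≡n; +-∸-assoc)
open import Data.Product using (∃; _×_; _,_; proj₁; proj₂)
open import Data.Sum using (_⊎_; inj₁; inj₂; [_,_]′; map₂)
open import Function using (_∘_; flip; _⇔_; mk⇔; Equivalence)
open import Function.Construct.Composition using (_⇔-∘_)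
open import Relation.Binary.Construct.Closure.Transitive as Plus using (TransClosure; [_]; _∷_)
open import Relation.Binary.PropositionalEquality using (_≡_; _≢_; refl; sym; trans; cong; subst; subst₂;
  module ≡-Reasoning)
open import Relation.Nullary using (¬_; Dec; yes; no)
open import Relation.Nullary.Decidable as Dec using (T?; toWitness; fromWitness; does; dec-true; dec-false)

open Equivalence using (to; from)

-- A symmetric partition of ±A without zero-block is encoded by the partial
-- equivalence relation R of lying in a common block, the cyclic order on A by
-- its successor relation N.

-- Peeling is driven by π, while patching runs back through the recorded layers, so `ψ` cannot be
-- inverted by unfolding its own recursion. The relation `Psi` removes the direction: a layer links
-- the partition before to the partition after and can be read from either side. Besides `mirror`
-- one needs `determined`: `Psi` is single-valued, even across a relabelling. With σ = ψ(π) and τ =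
-- ψ(ω(σ)), the step from ω(σ) to τ and the mirrored step from σ to π have inputs that correspond
-- under ω; hence so do the outputs, and ω(τ) = π.
--
-- The layer that deletes everything is exceptional. It leaves no t_j to attach to, and for r = 1
-- the only pair is a singleton and a left point at once. `Psi` therefore has the constructor
-- `collapse`, whose two alternatives the mirror exchanges; a `peel` layer keeps a survivor, so none
-- of its deleted elements is its own successor.

record SignedPER (A : ℕ → Set) (R : ℤ → ℤ → Set) : Set where
  field
    symmetric  : ∀ {x y} → R x y → R y x
    transitive : ∀ {x y z} → R x y → R y z → R x z
    negate     : ∀ {x y} → R x y → R (- x) (- y)
    antipode   : ∀ {x} → ¬ R x (- x)
    domain     : ∀ {x} → R x x ⇔ A ∣ x ∣

  reflˡ : ∀ {x y} → R x y → R x x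
  reflˡ r = transitive r (symmetric r)

  inDomain : ∀ {x y} → R x y → A ∣ x ∣
  inDomain = to domain ∘ reflˡ

  inDomainʳ : ∀ {x y} → R x y → A ∣ y ∣
  inDomainʳ = inDomain ∘ symmetric

-- `connected` also covers t = u, so it alone provides successors. A one-element set carries the
-- loop `N t t`, in accordance with t_(r+1) = t_1 for r = 1.
record Cyclic (A : ℕ → Set) (N : ℕ → ℕ → Set) : Set where
  field
    source     : ∀ {t u} → N t u → A t
    target     : ∀ {t u} → N t u → A u
    functional : ∀ {t u v} → N t u → N t v → u ≡ v
    injective  : ∀ {t u v} → N t v → N u v → t ≡ u
    connected  : ∀ {t u} → A t → A u → TransClosure N t u

  successor : ∀ {t} → A t → ∃ λ u → N t u
  successor a with connected a a
  ... | [ n ]   = _ , n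
  ... | (n ∷ _) = _ , n

reverse⁺ : ∀ {N : ℕ → ℕ → Set} {t u} → TransClosure N t u → TransClosure (flip N) u t
reverse⁺ [ n ]   = [ n ]
reverse⁺ (n ∷ p) = reverse⁺ p Plus.∷ʳ n

flipCyclic : ∀ {A N} → Cyclic A N → Cyclic A (flip N)
flipCyclic C = record
  { source = target ; target = source ; functional = injective ; injective = functional
  ; connected = λ a b → reverse⁺ (connected b a) }
  where open Cyclic C

-- A walk that starts at a loop never leaves it, so the loop is the whole cycle. This isolates r =
-- 1, the only case where a singleton can also be a left point.
fixedPoint⇒singleton : ∀ {A N} → Cyclic A N → ∀ {t u} → N t t → A u → u ≡ t
fixedPoint⇒singleton {A} {N} C {t} n a = walk (connected (source n) a)
  where
  open Cyclic C
  walk : ∀ {u} → TransClosure N t u → u ≡ t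
  walk [ m ] = functional m n
  walk (m ∷ p) with refl ← functional m n = walk p

Single : (ℤ → ℤ → Set) → ℕ → Set
Single R t = R (+ t) (+ t) × (∀ y → R (+ t) y → y ≡ + t)

Left : (ℕ → ℕ → Set) → (ℤ → ℤ → Set) → ℕ → Set
Left N R t = ∃ λ u → N t u × R (+ t) (+ u)

Right : (ℕ → ℕ → Set) → (ℤ → ℤ → Set) → ℕ → Set
Right N = Left (flip N)

Deleted : (ℕ → ℕ → Set) → (ℤ → ℤ → Set) → ℕ → Set
Deleted N R t = Single R t ⊎ Left N R t

-- Only the interior points must satisfy `D`. The same notion describes the successor that remains
-- after a deletion and the runs of singletons used in patching.
data Run (N : ℕ → ℕ → Set) (D : ℕ → Set) : ℕ → ℕ → Set where
  [_]     : ∀ {t u} → N t u → Run N D t u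
  _∷⟨_⟩_ : ∀ {t d u} → N t d → D d → Run N D d u → Run N D t u

snocRun : ∀ {N D t d u} → Run N D t d → D d → N d u → Run N D t u
snocRun [ n ]          d m = n ∷⟨ d ⟩ [ m ]
snocRun (n ∷⟨ e ⟩ r) d m = n ∷⟨ e ⟩ snocRun r d m

flipRun : ∀ {N D t u} → Run N D t u → Run (flip N) D u t
flipRun [ n ]          = [ n ]
flipRun (n ∷⟨ d ⟩ r) = snocRun (flipRun r) d n

mapRun : ∀ {N M D E} (c : ℕ → ℕ) → (∀ {t u} → N t u → M (c t) (c u)) → (∀ {t} → D t → E (c t)) →
  ∀ {t u} → Run N D t u → Run M E (c t) (c u)
mapRun c f g [ n ]          = [ f n ]
mapRun c f g (n ∷⟨ d ⟩ r) = f n ∷⟨ g d ⟩ mapRun c f g r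

runFunctional : ∀ {A N} {D : ℕ → Set} → Cyclic A N → ∀ {t u v} → ¬ D u → ¬ D v →
  Run N D t u → Run N D t v → u ≡ v
runFunctional C ¬u ¬v [ n ] [ m ] = Cyclic.functional C n m
runFunctional {D = D} C ¬u ¬v [ n ] (m ∷⟨ d ⟩ r) = ⊥-elim (¬u (subst D (Cyclic.functional C m n) d))
runFunctional {D = D} C ¬u ¬v (m ∷⟨ d ⟩ r) [ n ] = ⊥-elim (¬v (subst D (Cyclic.functional C m n) d))
runFunctional C ¬u ¬v (n ∷⟨ d ⟩ r) (m ∷⟨ e ⟩ s) with refl ← Cyclic.functional C n m =
  runFunctional C ¬u ¬v r s

runTarget : ∀ {A N} {D : ℕ → Set} → Cyclic A N → ∀ {t u} → Run N D t u → A u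
runTarget C [ n ]          = Cyclic.target C n
runTarget C (n ∷⟨ d ⟩ r) = runTarget C r

runSource : ∀ {A N} {D : ℕ → Set} → Cyclic A N → ∀ {t u} → Run N D t u → A t
runSource C [ n ]          = Cyclic.source C n
runSource C (n ∷⟨ d ⟩ r) = Cyclic.source C n

-- The given path to a survivor bounds the search, which makes the recursion structural.
firstSurvivor : ∀ {A N} {D : ℕ → Set} → Cyclic A N → (∀ t → A t → Dec (D t)) →
  ∀ {t p} → TransClosure N t p → ¬ D p → ∃ λ v → ¬ D v × Run N D t v
firstSurvivor C dec [ n ] ¬p = _ , ¬p , [ n ]
firstSurvivor C dec (_∷_ {y = q} n r) ¬p with dec q (Cyclic.target C n)
... | no ¬q = q , ¬q , [ n ]
... | yes d with v , ¬v , s ← firstSurvivor C dec r ¬p = v , ¬v , (n ∷⟨ d ⟩ s)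

Induced : (ℕ → ℕ → Set) → (ℕ → Set) → ℕ → ℕ → Set
Induced N D t u = ¬ D t × ¬ D u × Run N D t u

Restrict : (ℤ → ℤ → Set) → (ℕ → Set) → ℤ → ℤ → Set
Restrict R D x y = ¬ D ∣ x ∣ × ¬ D ∣ y ∣ × R x y

AllRelated : (ℕ → Set) → (ℤ → ℤ → Set) → Set
AllRelated A R = ∀ {t u} → A t → A u → R (+ t) (+ u)

AllSingle : (ℕ → Set) → (ℤ → ℤ → Set) → Set
AllSingle A R = ∀ {t} → A t → Single R t

record Frame (A : ℕ → Set) (N : ℕ → ℕ → Set) (R R' : ℤ → ℤ → Set) : Set where
  field
    cyclic  : Cyclic A N
    before  : SignedPER A R
    after   : SignedPER A R'

flipFrame : ∀ {A N R R'} → Frame A N R R' → Frame A (flip N) R' R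
flipFrame F = record { cyclic = flipCyclic cyclic ; before = after ; after = before }
  where open Frame F

-- `deleted` and `survivor` make a layer incompatible with `stop` and `collapse`. `attached` speaks
-- of the immediate predecessor only; transitivity along a run then reaches the base t_j.
record Layer (A : ℕ → Set) (N : ℕ → ℕ → Set) (R R' : ℤ → ℤ → Set)
    (N₁ : ℕ → ℕ → Set) (R₁ R₁' : ℤ → ℤ → Set) : Set where
  field
    decide   : ∀ t → A t → Dec (Deleted N R t)
    deleted  : ∃ λ t → A t × Deleted N R t
    survivor : ∃ λ t → A t × ¬ Deleted N R t
    next     : ∀ {t u} → N₁ t u ⇔ Induced N (Deleted N R) t u
    inner    : ∀ {x y} → R₁ x y ⇔ Restrict R (Deleted N R) x y
    inner'   : ∀ {x y} → R₁' x y ⇔ Restrict R' (Deleted N R) x y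
    isolate  : ∀ {t} → Left N R t → Single R' t
    attached : ∀ {p s} → N p s → Single R s → R' (+ p) (+ s)

-- Psi A N R R' is the graph of ψ : R' is obtained from R by peeling and patching.
data Psi (A : ℕ → Set) (N : ℕ → ℕ → Set) (R R' : ℤ → ℤ → Set) : Set₁ where
  stop : Frame A N R R' → (∀ t → ¬ Deleted N R t) → (∀ {x y} → R x y ⇔ R' x y) → Psi A N R R'
  collapse : Frame A N R R' → ∃ A →
    (AllRelated A R × AllSingle A R') ⊎ (AllSingle A R × AllRelated A R') → Psi A N R R'
  peel : ∀ {A₁ N₁ R₁ R₁'} → Frame A N R R' → Layer A N R R' N₁ R₁ R₁' →
    Psi A₁ N₁ R₁ R₁' → Psi A N R R'

SameSign : ℤ → ℤ → Set
SameSign x y = (x ≡ + ∣ x ∣ × y ≡ + ∣ y ∣) ⊎ (x ≡ - (+ ∣ x ∣) × y ≡ - (+ ∣ y ∣))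

signCases : ∀ x → x ≡ + ∣ x ∣ ⊎ x ≡ - (+ ∣ x ∣)
signCases (+ n)    = inj₁ refl
signCases -[1+ n ] = inj₂ refl

module PER {A : ℕ → Set} {R : ℤ → ℤ → Set} (P : SignedPER A R) where
  open SignedPER P

  sameAbs : ∀ {x y} → R x y → ∣ x ∣ ≡ ∣ y ∣ → x ≡ y
  sameAbs {x} {y} r e with signCases x | signCases y
  ... | inj₁ p | inj₁ q = trans p (trans (cong (λ z → + z) e) (sym q))
  ... | inj₂ p | inj₂ q = trans p (trans (cong (λ z → - (+ z)) e) (sym q))
  ... | inj₁ p | inj₂ q = ⊥-elim (antipode (subst (R x)
          (trans q (cong -_ (trans (cong (λ z → + z) (sym e)) (sym p)))) r))
  ... | inj₂ p | inj₁ q = ⊥-elim (antipode (subst (R x)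
          (trans q (trans (cong (λ z → + z) (sym e)) (trans (sym (neg-involutive _)) (cong -_ (sym p))))) r))

  signedSingle : ∀ {x y} → Single R ∣ x ∣ → R x y → y ≡ x
  signedSingle {x} {y} (_ , s) r with signCases x
  ... | inj₁ p = trans (s y (subst (λ z → R z y) p r)) (sym p)
  ... | inj₂ p = trans (sym (neg-involutive y)) (trans (cong -_
        (s (- y) (subst (λ z → R z (- y)) (trans (cong -_ p) (neg-involutive _)) (negate r)))) (sym p))

  lift : ∀ x {t v} → ∣ x ∣ ≡ t → R (+ t) (+ v) → ∃ λ z → ∣ z ∣ ≡ v × R x z
  lift x {t} {v} refl r with signCases x
  ... | inj₁ p = + v , refl , subst (λ z → R z (+ v)) (sym p) r
  ... | inj₂ p = - (+ v) , ∣-i∣≡∣i∣ (+ v) , subst (λ z → R z (- (+ v))) (sym p) (negate r)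

-- Exchange of singletons and adjacencies.

deletedInDomain : ∀ {A N R} → Cyclic A N → SignedPER A R → ∀ {t} → Deleted N R t → A t
deletedInDomain C P (inj₁ (r , _))     = SignedPER.inDomain P r
deletedInDomain C P (inj₂ (_ , n , _)) = Cyclic.source C n

-- When everything is deleted, being a left point propagates around the cycle: the successor of a
-- left point cannot be a singleton unless it is the same point. So one left point relates all
-- elements, and otherwise all are singletons. Patching an empty partition relies on this dichotomy.
allDeleted : ∀ {A N R} → Cyclic A N → SignedPER A R → ∃ A → (∀ {t} → A t → Deleted N R t) →
  AllRelated A R ⊎ AllSingle A R
allDeleted {A} {N} {R} C P (t₀ , a₀) del = go (del a₀)
  where
  open Cyclic C
  open SignedPER P
  leftPath : ∀ {t u} → Left N R t → TransClosure N t u → R (+ t) (+ u)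
  leftPath (_ , m , r) [ n ] with refl ← functional m n = r
  leftPath l@(_ , m , r) (n ∷ p) with refl ← functional m n with del (target n)
  ... | inj₂ l' = transitive r (leftPath l' p)
  -- A singleton following a left point equals it, so this step is a loop and the walk goes on from
  -- the same left point.
  ... | inj₁ (_ , s) with refl ← s _ (symmetric r) = leftPath l p
  go : Deleted N R t₀ → AllRelated A R ⊎ AllSingle A R
  go (inj₂ l) = inj₁ λ a b → transitive (symmetric (leftPath l (connected a₀ a))) (leftPath l (connected a₀ b))
  go (inj₁ σ) = inj₂ single
    where
    single : ∀ {t} → A t → Single R t
    single a with del a
    ... | inj₁ τ = τ
    ... | inj₂ l with refl ← proj₂ σ _ (symmetric (leftPath l (connected a a₀))) = σ

-- The first equivalence holds because both sides amount to membership in `A`. The second one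
-- concerns r = 1 only: a right point of a discrete partition, like a singleton of a full one, is
-- its own predecessor.
exchangeCollapse : ∀ {A N R R'} → Frame A N R R' → AllRelated A R → AllSingle A R' →
  (∀ t → Single R' t ⇔ Left N R t) × (∀ t → Right N R' t ⇔ Single R t)
exchangeCollapse {A} {N} {R} {R'} F full disc = (λ t → mk⇔ ltr rtl) , (λ t → mk⇔ rts str)
  where
  open Frame F
  open Cyclic cyclic
  module B = SignedPER before
  module A' = SignedPER after
  ltr : ∀ {t} → Single R' t → Left N R t
  ltr (r , _) with u , n ← successor (A'.inDomain r) = u , n , full (source n) (target n)
  rtl : ∀ {t} → Left N R t → Single R' t
  rtl (u , n , _) = disc (source n)
  rts : ∀ {t} → Right N R' t → Single R t
  rts {t} (u , n , r) with refl ← proj₂ (disc (target n)) _ r = from B.domain (target n) , λ y s →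
    sym (PER.sameAbs before s (sym (fixedPoint⇒singleton cyclic n (B.inDomainʳ s))))
  str : ∀ {t} → Single R t → Right N R' t
  str {t} (r , s) with u , n ← Cyclic.successor (flipCyclic cyclic) (B.inDomain r)
    with refl ← s _ (full (target n) (source n)) = t , n , from A'.domain (target n)

module Peeled {A N R R' N₁ R₁ R₁'} (F : Frame A N R R') (L : Layer A N R R' N₁ R₁ R₁') where
  open Frame F public
  open Layer L public
  open Cyclic cyclic public
  module B  = SignedPER before
  module A' = SignedPER after

  D : ℕ → Set
  D = Deleted N R

  -- A loop at a deleted point would leave no room for the survivor.
  noFixedPoint : ∀ {t} → D t → ¬ N t t
  noFixedPoint d n with v , a , ¬v ← survivor
    with refl ← fixedPoint⇒singleton cyclic n a = ¬v d

  runForward : ∀ {t} → A t → ∃ λ v → ¬ D v × Run N D t v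
  runForward a with _ , b , ¬p ← survivor = firstSurvivor cyclic decide (connected a b) ¬p

  runBackward : ∀ {t} → A t → ∃ λ v → ¬ D v × Run (flip N) D t v
  runBackward a with _ , b , ¬p ← survivor =
    firstSurvivor (flipCyclic cyclic) decide (reverse⁺ (connected b a)) ¬p

  -- All elements of the run are left points.
  leftRun : ∀ {d v} → Left N R d → Run N D d v → R (+ d) (+ v) × Right N R v
  leftRun (_ , m , r) [ n ] with refl ← functional m n = r , _ , n , B.symmetric r
  leftRun (u , m , r) (n ∷⟨ e ⟩ s) with refl ← functional m n with e
  ... | inj₁ (_ , single) with refl ← single _ (B.symmetric r) = leftRun (_ , m , r) s
  ... | inj₂ l with q , right ← leftRun l s = B.transitive r q , right

  -- All elements of the run are singletons.
  singleRun : ∀ {s v} → Single R s → Run (flip N) D s v → R' (+ v) (+ s)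
  singleRun σ [ n ] = attached n σ
  singleRun {s} σ (n ∷⟨ inj₁ δ ⟩ r) = A'.transitive (singleRun δ r) (attached n σ)
  singleRun {s} σ (n ∷⟨ inj₂ (_ , m , q) ⟩ r) with refl ← functional m n
    with refl ← proj₂ σ _ (B.symmetric q) = A'.transitive (singleRun σ r) (attached n σ)

  -- The two parameters are the induction hypothesis for the inner layer.
  module Exchange (single₁ : ∀ t → Single R₁' t ⇔ Left N₁ R₁ t)
                  (right₁ : ∀ t → Right N₁ R₁' t ⇔ Single R₁ t) where

    -- A singleton of `R` is attached to its predecessor, so it stays alone only at a loop. For a
    -- survivor, the induction hypothesis relates it in `R` to the next survivor, and it remains to
    -- look at the first element between them.
    single⇒left : ∀ t → Single R' t → Left N R t
    single⇒left t σ@(r , s) with decide t (A'.inDomain r)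
    ... | yes (inj₂ l) = l
    ... | yes (inj₁ δ) with p , n ← Cyclic.successor (flipCyclic cyclic) (A'.inDomain r)
      with refl ← s _ (A'.symmetric (attached n δ)) = ⊥-elim (noFixedPoint (inj₁ δ) n)
    single⇒left t σ@(r , s) | no ¬t = go (to (single₁ t)
        (from inner' (¬t , ¬t , r) , λ y q → s y (proj₂ (proj₂ (to inner' q)))))
      where
      go : Left N₁ R₁ t → Left N R t
      go (v , n₁ , q) with to next n₁ | to inner q
      ... | _ , _ , [ n ] | _ , _ , r₀ = v , n , r₀
      -- A singleton directly after t is attached to the block of t in `R'`; as t is alone there,
      -- the two coincide and t was deleted after all.
      ... | _ , _ , (n ∷⟨ inj₁ δ ⟩ _) | _ with refl ← s _ (attached n δ) = ⊥-elim (¬t (inj₁ δ))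
      -- A left point directly after t lies in the block of the next survivor, which is also the
      -- block of t.
      ... | _ , _ , (n ∷⟨ inj₂ l ⟩ run) | _ , _ , r₀ =
        _ , n , B.transitive r₀ (B.symmetric (proj₁ (leftRun l run)))

    single⇒right : ∀ t → Single R t → Right N R' t
    single⇒right t σ with p , n ← Cyclic.successor (flipCyclic cyclic) (B.inDomain (proj₁ σ)) =
      p , n , A'.symmetric (attached n σ)

    -- A survivor that became a singleton lost its block mates, which were left
    -- points; hence its predecessor is a left point of its block.
    private
      notNewSingle : ∀ {t} → ¬ D t → Single R₁ t → ¬ Right N R t → ⊥
      notNewSingle {t} ¬t (r , s) ¬r = ¬t (inj₁ (proj₂ (proj₂ (to inner r)) , alone))
        where
        alone : ∀ y → R (+ t) y → y ≡ + t
        alone y q with decide ∣ y ∣ (B.inDomainʳ q)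
        ... | no ¬y = s y (from inner (¬t , ¬y , q))
        ... | yes (inj₁ δ) = sym (PER.signedSingle before δ (B.symmetric q))
        ... | yes (inj₂ l) with v , ¬v , run ← runForward (B.inDomainʳ q)
          with p , right ← leftRun l run
          with z , e , ρ ← PER.lift before y refl p
          with s z (from inner (¬t , (λ d → ¬v (subst D e d)) , B.transitive q ρ))
        ... | refl with refl ← e = ⊥-elim (¬r right)

    -- Left points are isolated in `R'`, so neither t nor its predecessor u is one. If t survives,
    -- the induction hypothesis makes it a singleton of `R₁`, and `notNewSingle` then asks for t to
    -- be a right point of `R`. That would make u a left point, or equal to t if u is a singleton.
    right⇒single : ∀ t → Right N R' t → Single R t
    right⇒single t (u , n , r) with decide t (target n)
    ... | yes (inj₁ σ) = σ
    ... | yes (inj₂ l) with refl ← proj₂ (isolate l) _ r = ⊥-elim (noFixedPoint (inj₂ l) n)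
    ... | no ¬t with decide u (source n)
    ...   | yes (inj₂ l) with refl ← proj₂ (isolate l) _ (A'.symmetric r) = ⊥-elim (¬t (inj₂ l))
    ...   | no ¬u = ⊥-elim (notNewSingle ¬t
              (to (right₁ t) (u , from next (¬u , ¬t , [ n ]) , from inner' (¬t , ¬u , r)))
              λ (w , m , q) → ¬u (inj₂ (t , subst (λ z → N z t) (injective m n) m
                                          , B.symmetric (subst (λ z → R (+ t) (+ z)) (injective m n) q))))
    -- The singletons before t all join the block of the survivor v that precedes them, so v and t
    -- are consecutive and related in the inner layer.
    ...   | yes (inj₁ σ) with v , ¬v , run ← runBackward (source n) = ⊥-elim (notNewSingle ¬t
              (to (right₁ t) (v , from next (¬v , ¬t , flipRun (n ∷⟨ inj₁ σ ⟩ run))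
                , from inner' (¬t , ¬v , A'.transitive r (A'.symmetric (singleRun σ run)))))
              λ (w , m , q) → ¬t (inj₁ (subst (Single R)
                (sym (+-injective (proj₂ σ _ (B.symmetric (subst (λ z → R (+ t) (+ z)) (injective m n) q))))) σ)))

exchange : ∀ {A N R R'} → Psi A N R R' →
  (∀ t → Single R' t ⇔ Left N R t) × (∀ t → Right N R' t ⇔ Single R t)
exchange {N = N} {R} {R'} (stop F ¬d e) =
    (λ t → mk⇔ (λ (r , s) → ⊥-elim (¬d t (inj₁ (from e r , λ y q → s y (to e q)))))
               (λ l → ⊥-elim (¬d t (inj₂ l))))
  , (λ t → mk⇔ (λ (u , n , r) → ⊥-elim (¬d u (inj₂ (t , n , SignedPER.symmetric (Frame.before F) (from e r)))))
               (λ σ → ⊥-elim (¬d t (inj₁ σ))))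
exchange (collapse F _ (inj₁ (full , disc))) = exchangeCollapse F full disc
-- Flipping the frame swaps `R` with `R'` and left with right points, so the two equivalences of the
-- other alternative return in swapped order and with their sides exchanged.
exchange (collapse F _ (inj₂ (disc , full))) with e , e' ← exchangeCollapse (flipFrame F) full disc =
  (λ t → mk⇔ (from (e' t)) (to (e' t))) , (λ t → mk⇔ (from (e t)) (to (e t)))
exchange (peel F L ψ) with e , e' ← exchange ψ =
    (λ t → mk⇔ (single⇒left t) isolate) , (λ t → mk⇔ (right⇒single t) (single⇒right t))
  where
  open Peeled F L
  open Exchange e e'

-- Symmetry of the graph under reversal.

-- `exchange` turns the two reasons for deletion into each other. Both directions therefore delete
-- the same elements, and the layers of the two peelings match one by one.
deletedMirror : ∀ {A N R R'} → Psi A N R R' → ∀ {t} → Deleted (flip N) R' t ⇔ Deleted N R t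
deletedMirror ψ {t} with e , e' ← exchange ψ = mk⇔
  (λ { (inj₁ σ) → inj₂ (to (e t) σ) ; (inj₂ r) → inj₁ (to (e' t) r) })
  (λ { (inj₁ σ) → inj₂ (from (e' t) σ) ; (inj₂ l) → inj₁ (from (e t) l) })

mirror : ∀ {A N R R'} → Psi A N R R' → Psi A (flip N) R' R
mirror ψ@(stop F ¬d e) = stop (flipFrame F) (λ t → ¬d t ∘ to (deletedMirror ψ)) (mk⇔ (from e) (to e))
mirror (collapse F a (inj₁ (f , d))) = collapse (flipFrame F) a (inj₂ (d , f))
mirror (collapse F a (inj₂ (d , f))) = collapse (flipFrame F) a (inj₁ (f , d))
mirror {N = N} {R} {R'} ψ@(peel {N₁ = N₁} {R₁} {R₁'} F L ψ₁) = peel (flipFrame F) L' (mirror ψ₁)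
  where
  open Peeled F L
  D' = Deleted (flip N) R'
  x = exchange ψ
  back : ∀ {t} → D' t → D t
  back = to (deletedMirror ψ)
  forth : ∀ {t} → D t → D' t
  forth = from (deletedMirror ψ)
  decide' : ∀ t → _ → Dec (D' t)
  decide' t a with decide t a
  ... | yes d = yes (forth d)
  ... | no ¬d = no (¬d ∘ back)
  next' : ∀ {t u} → N₁ u t ⇔ Induced (flip N) D' t u
  next' = mk⇔
    (λ n → let ¬u , ¬t , r = to next n in ¬t ∘ back , ¬u ∘ back , mapRun (λ z → z) (λ m → m) forth (flipRun r))
    (λ (¬t , ¬u , r) → from next (¬u ∘ forth , ¬t ∘ forth , mapRun (λ z → z) (λ m → m) back (flipRun r)))
  restrict : ∀ {Q : ℤ → ℤ → Set} {x y} → Restrict Q D x y ⇔ Restrict Q D' x y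
  restrict = mk⇔ (λ (¬x , ¬y , r) → ¬x ∘ back , ¬y ∘ back , r)
                 (λ (¬x , ¬y , r) → ¬x ∘ forth , ¬y ∘ forth , r)
  -- A singleton of `R'` is a left point of `R`, so `R` already joins it to its successor, which is
  -- its predecessor in the reversed order.
  attached' : ∀ {p s} → N s p → Single R' s → R (+ p) (+ s)
  attached' n σ with u , m , r ← to (proj₁ x _) σ with refl ← functional m n = B.symmetric r
  L' : Layer _ (flip N) R' R (flip N₁) R₁' R₁
  L' = record
    { decide = decide'
    ; deleted = let t , a , d = deleted in t , a , forth d
    ; survivor = let t , a , ¬d = survivor in t , a , ¬d ∘ back
    ; next = next'
    ; inner = λ {x} {y} → restrict {R'} {x} {y} ⇔-∘ inner'
    ; inner' = λ {x} {y} → restrict {R} {x} {y} ⇔-∘ inner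
    ; isolate = λ r → to (proj₂ x _) r
    ; attached = attached' }

-- Relabelling, and determinism of the graph.

-- This is the extension of a map on absolute values to an odd map; at zero, oddness amounts to
-- `c 0 ≡ 0`.
signed : (ℕ → ℕ) → ℤ → ℤ
signed c (+ n)    = + c n
signed c -[1+ n ] = - (+ c (suc n))

signed-neg : ∀ {r} → r 0 ≡ 0 → ∀ x → signed r (- x) ≡ - signed r x
signed-neg e (+ zero)  = trans (cong (λ z → + z) e) (cong (λ z → - (+ z)) (sym e))
signed-neg e (+ suc n) = refl
signed-neg e -[1+ n ]  = sym (neg-involutive _)

∣signed∣ : ∀ r x → ∣ signed r x ∣ ≡ r ∣ x ∣
∣signed∣ r (+ n)    = refl
∣signed∣ r -[1+ n ] = ∣-i∣≡∣i∣ (+ r (suc n))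

-- It abstracts the action of ω on absolute values. Because `c` is its own inverse, properties are
-- transported in one direction and reversed through `invertNext` and `invertPER`.
record Relabelling : Set where
  field
    c          : ℕ → ℕ
    involutive : ∀ t → c (c t) ≡ t
    fixesZero  : c 0 ≡ 0

  ĉ : ℤ → ℤ
  ĉ = signed c

  ĉ-neg : ∀ x → ĉ (- x) ≡ - ĉ x
  ĉ-neg = signed-neg fixesZero

  ĉ-involutive : ∀ x → ĉ (ĉ x) ≡ x
  ĉ-involutive (+ n)    = cong (λ z → + z) (involutive n)
  ĉ-involutive -[1+ n ] = trans (ĉ-neg (+ c (suc n))) (cong (λ z → - (+ z)) (involutive (suc n)))

  ∣ĉ∣ : ∀ x → ∣ ĉ x ∣ ≡ c ∣ x ∣
  ∣ĉ∣ = ∣signed∣ c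

  record NextIso (N M : ℕ → ℕ → Set) : Set where
    field at : ∀ {t u} → N t u ⇔ M (c t) (c u)

  record PERIso (R Q : ℤ → ℤ → Set) : Set where
    field at : ∀ {x y} → R x y ⇔ Q (ĉ x) (ĉ y)

  module _ {N M} (ν : NextIso N M) where
    open NextIso ν

    invertNext : NextIso M N
    invertNext .NextIso.at {t} {u} = mk⇔
      (λ m → from at (subst₂ M (sym (involutive t)) (sym (involutive u)) m))
      (λ n → subst₂ M (involutive t) (involutive u) (to at n))

  module _ {R Q} (ρ : PERIso R Q) where
    open PERIso ρ

    invertPER : PERIso Q R
    invertPER .PERIso.at {x} {y} = mk⇔
      (λ q → from at (subst₂ Q (sym (ĉ-involutive x)) (sym (ĉ-involutive y)) q))
      (λ r → subst₂ Q (ĉ-involutive x) (ĉ-involutive y) (to at r))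

  relabelSingle : ∀ {R Q} → PERIso R Q → ∀ {t} → Single R t → Single Q (c t)
  relabelSingle {R} ρ {t} (r , s) = to (PERIso.at ρ) r , λ y q →
    trans (sym (ĉ-involutive y)) (cong ĉ (s (ĉ y)
      (subst (λ z → R z (ĉ y)) (cong (λ z → + z) (involutive t)) (to (PERIso.at (invertPER ρ)) q))))

  relabelLeft : ∀ {N M R Q} → NextIso N M → PERIso R Q → ∀ {t} → Left N R t → Left M Q (c t)
  relabelLeft ν ρ (u , n , r) = c u , to (NextIso.at ν) n , to (PERIso.at ρ) r

  relabelDeleted : ∀ {N M R Q} → NextIso N M → PERIso R Q →
    ∀ {t} → Deleted N R t → Deleted M Q (c t)
  relabelDeleted ν ρ (inj₁ σ) = inj₁ (relabelSingle ρ σ)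
  relabelDeleted ν ρ (inj₂ l) = inj₂ (relabelLeft ν ρ l)

  keepUndeleted : ∀ {N M R Q} → NextIso N M → PERIso R Q →
    ∀ {t} → ¬ Deleted N R t → ¬ Deleted M Q (c t)
  keepUndeleted {N} {R = R} ν ρ {t} ¬d d = ¬d (subst (Deleted N R) (involutive t)
    (relabelDeleted (invertNext ν) (invertPER ρ) d))

-- Were the signs opposite, the relation between the absolute values would close up to a relation
-- between antipodes.
sameSigns : ∀ {A R} → SignedPER A R → AllRelated A R → ∀ {x y} → R x y → SameSign x y
sameSigns {R = R} P full {x} {y} r with signCases x | signCases y
... | inj₁ p | inj₁ q = inj₁ (p , q)
... | inj₂ p | inj₂ q = inj₂ (p , q)
... | inj₁ p | inj₂ q = ⊥-elim (antipode (transitive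
        (subst₂ R p q r) (negate (full (inDomainʳ r) (inDomain r)))))
  where open SignedPER P
... | inj₂ p | inj₁ q = ⊥-elim (antipode (transitive
        (full (inDomain r) (inDomainʳ r)) (symmetric (subst₂ R p q r))))
  where open SignedPER P

collapseDeleted : ∀ {A N R R'} → Frame A N R R' →
  (AllRelated A R × AllSingle A R') ⊎ (AllSingle A R × AllRelated A R') → ∀ {t} → A t → Deleted N R t
collapseDeleted F (inj₂ (disc , _)) a = inj₁ (disc a)
collapseDeleted F (inj₁ (full , _)) a with u , n ← Cyclic.successor (Frame.cyclic F) a =
  inj₂ (u , n , full a (Cyclic.target (Frame.cyclic F) n))

module Determinism (relabelling : Relabelling) where
  open Relabelling relabelling

  module _ {A B N M R Q R' Q'} (F : Frame A N R R') (G : Frame B M Q Q')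
      (ν : NextIso N M) (ρ : PERIso R Q) where
    open Frame

    relabelDomain : ∀ {t} → A t → B (c t)
    relabelDomain a = SignedPER.inDomain (before G)
      (to (PERIso.at ρ) (from (SignedPER.domain (before F) {+ _}) a))

    relabelRefl : ∀ {x y} → R' x y → Q' (ĉ x) (ĉ x)
    relabelRefl {x} r = from (SignedPER.domain (after G)) (subst B (sym (∣ĉ∣ x))
      (relabelDomain (SignedPER.inDomain (after F) r)))

    relabelDiscrete : ∀ {x y} → R' x y → Single R' ∣ x ∣ → Q' (ĉ x) (ĉ y)
    relabelDiscrete {x} {y} r σ with refl ← PER.signedSingle (after F) σ r = relabelRefl r

    relabelFull : AllRelated A R' → AllRelated B Q' → ∀ {x y} → R' x y → Q' (ĉ x) (ĉ y)
    relabelFull full full' {x} {y} r with b ← relabelDomain (SignedPER.inDomain (after F) r)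
      | b' ← relabelDomain (SignedPER.inDomainʳ (after F) r) | sameSigns (after F) full r
    ... | inj₁ (p , q) = subst₂ (λ x y → Q' (ĉ x) (ĉ y)) (sym p) (sym q) (full' b b')
    ... | inj₂ (p , q) = subst₂ (λ x y → Q' (ĉ x) (ĉ y)) (sym p) (sym q)
            (subst₂ Q' (sym (ĉ-neg (+ ∣ x ∣))) (sym (ĉ-neg (+ ∣ y ∣))) (SignedPER.negate (after G) (full' b b')))

    relabelCollapse :
      (AllRelated A R × AllSingle A R') ⊎ (AllSingle A R × AllRelated A R') →
      (AllRelated B Q × AllSingle B Q') ⊎ (AllSingle B Q × AllRelated B Q') →
      ∀ {x y} → R' x y → Q' (ĉ x) (ĉ y)
    relabelCollapse (inj₁ (_ , disc)) _ r = relabelDiscrete r (disc (SignedPER.inDomain (after F) r))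
    relabelCollapse (inj₂ (_ , full)) (inj₂ (_ , full')) r = relabelFull full full' r
    -- `R` is discrete and the isomorphic `Q` is full, so there is only one positive element, and
    -- reflexivity suffices.
    relabelCollapse (inj₂ (disc , full)) (inj₁ (full' , _)) {x} {y} r
      with refl ← PER.sameAbs (after F) r (sym (+-injective (proj₂ (disc (SignedPER.inDomain (after F) r)) (+ ∣ y ∣)
        (from (PERIso.at ρ) (full' (relabelDomain (SignedPER.inDomain (after F) r))
                                   (relabelDomain (SignedPER.inDomainʳ (after F) r))))))) = relabelRefl r

  -- Different constructors cannot meet: `stop` deletes nothing, `collapse` everything, and `peel`
  -- something but not all, and deletion is invariant under relabelling. One implication is enough
  -- here, since the other follows by exchanging the two derivations and inverting the isomorphisms.
  determined : ∀ {A B N M R Q R' Q'} → Psi A N R R' → Psi B M Q Q' → NextIso N M → PERIso R Q →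
    ∀ {x y} → R' x y → Q' (ĉ x) (ĉ y)
  determined (stop F ¬d e) (stop G ¬d' e') ν ρ r = to e' (to (PERIso.at ρ) (from e r))
  determined (stop F ¬d e) (collapse G (_ , b) h) ν ρ r =
    ⊥-elim (¬d _ (relabelDeleted (invertNext ν) (invertPER ρ) (collapseDeleted G h b)))
  determined (stop F ¬d e) (peel G L _) ν ρ r with t , _ , d ← Layer.deleted L =
    ⊥-elim (¬d (c t) (relabelDeleted (invertNext ν) (invertPER ρ) d))
  determined (collapse F (_ , a) h) (stop G ¬d' e') ν ρ r =
    ⊥-elim (¬d' _ (relabelDeleted ν ρ (collapseDeleted F h a)))
  determined (collapse F _ h) (collapse G _ h') ν ρ r = relabelCollapse F G ν ρ h h' r
  determined (collapse F _ h) (peel G L _) ν ρ r with t , b , ¬d ← Layer.survivor L =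
    ⊥-elim (keepUndeleted (invertNext ν) (invertPER ρ) ¬d
      (collapseDeleted F h (relabelDomain G F (invertNext ν) (invertPER ρ) b)))
  determined (peel F L _) (stop G ¬d' e') ν ρ r with t , _ , d ← Layer.deleted L =
    ⊥-elim (¬d' _ (relabelDeleted ν ρ d))
  determined (peel F L _) (collapse G _ h) ν ρ r with t , a , ¬d ← Layer.survivor L =
    ⊥-elim (keepUndeleted ν ρ ¬d (collapseDeleted G h (relabelDomain F G ν ρ a)))
  determined {A} {N = N} {M} {R} {Q} {R'} {Q'} (peel {N₁ = N₁} {R₁} {R₁'} F L ψ₁)
      (peel {N₁ = M₁} {Q₁} {Q₁'} G K φ₁) ν ρ {x} {y} r₀ = conclude
    where
    open Peeled F L
    module P = Peeled G K
    ν₁ : NextIso N₁ M₁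
    ν₁ .NextIso.at {t} {u} = mk⇔
      (λ n → let ¬t , ¬u , r = to next n in from P.next (keepUndeleted ν ρ ¬t , keepUndeleted ν ρ ¬u
               , mapRun c (to (NextIso.at ν)) (relabelDeleted ν ρ) r))
      (λ m → let ¬t , ¬u , r = to P.next m in from next ((λ d → ¬t (relabelDeleted ν ρ d))
               , (λ d → ¬u (relabelDeleted ν ρ d))
               , subst₂ (Run N D) (involutive t) (involutive u)
                   (mapRun c (to (NextIso.at (invertNext ν))) (relabelDeleted (invertNext ν) (invertPER ρ)) r)))
    keep : ∀ x → ¬ D ∣ x ∣ → ¬ P.D ∣ ĉ x ∣
    keep x ¬d = subst (λ t → ¬ P.D t) (sym (∣ĉ∣ x)) (keepUndeleted ν ρ ¬d)
    unkeep : ∀ x → ¬ P.D ∣ ĉ x ∣ → ¬ D ∣ x ∣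
    unkeep x ¬d d = ¬d (subst P.D (sym (∣ĉ∣ x)) (relabelDeleted ν ρ d))
    ρ₁ : PERIso R₁ Q₁
    ρ₁ .PERIso.at {x} {y} = mk⇔
      (λ r → let ¬x , ¬y , r = to inner r in from P.inner (keep x ¬x , keep y ¬y , to (PERIso.at ρ) r))
      (λ q → let ¬x , ¬y , q = to P.inner q in from inner (unkeep x ¬x , unkeep y ¬y , from (PERIso.at ρ) q))
    -- Unless t becomes isolated, one survivor v holds it on both sides: `c` carries the backward
    -- run from t to v to a run of `M`, so the image of t is attached to the image of v.
    anchor : ∀ {t} → A t →
      Left N R t ⊎ ∃ λ v → ¬ D v × R' (+ t) (+ v) × Q' (ĉ (+ t)) (ĉ (+ v))
    anchor {t} a with decide t a
    ... | no ¬t = inj₂ (t , ¬t , from A'.domain a , relabelRefl F G ν ρ {y = + t} (from A'.domain a))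
    ... | yes (inj₂ l) = inj₁ l
    ... | yes (inj₁ σ) with v , ¬v , run ← runBackward a = inj₂ (v , ¬v , A'.symmetric (singleRun σ run)
        , P.A'.symmetric (P.singleRun (relabelSingle ρ σ)
            (mapRun c (to (NextIso.at ν)) (relabelDeleted ν ρ) run)))
    signedAnchor : ∀ x → A ∣ x ∣ →
      Left N R ∣ x ∣ ⊎ ∃ λ z → ¬ D ∣ z ∣ × R' x z × Q' (ĉ x) (ĉ z)
    signedAnchor x a with anchor a | signCases x
    ... | inj₁ l | _ = inj₁ l
    ... | inj₂ (v , ¬v , r , q) | inj₁ p =
      inj₂ (+ v , ¬v , subst (λ x → R' x (+ v)) (sym p) r , subst (λ x → Q' (ĉ x) (+ c v)) (sym p) q)
    ... | inj₂ (v , ¬v , r , q) | inj₂ p = inj₂ (- (+ v) , subst (λ t → ¬ D t) (sym (∣-i∣≡∣i∣ (+ v))) ¬v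
        , subst (λ x → R' x (- (+ v))) (sym p) (A'.negate r)
        , subst₂ Q' (trans (sym (ĉ-neg (+ ∣ x ∣))) (cong ĉ (sym p))) (sym (ĉ-neg (+ v))) (P.A'.negate q))
    -- Both points are moved to survivors, where the inner derivations agree by induction. An
    -- isolated point is related to itself only.
    conclude : Q' (ĉ x) (ĉ y)
    conclude with signedAnchor x (A'.inDomain r₀) | signedAnchor y (A'.inDomainʳ r₀)
    ... | inj₁ l | _ = relabelDiscrete F G ν ρ r₀ (isolate l)
    ... | _ | inj₁ l = P.A'.symmetric (relabelDiscrete F G ν ρ (A'.symmetric r₀) (isolate l))
    ... | inj₂ (z , ¬z , r , q) | inj₂ (w , ¬w , s , q') = P.A'.transitive q (P.A'.transitive
      (proj₂ (proj₂ (to P.inner' (determined ψ₁ φ₁ ν₁ ρ₁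
        (from inner' (¬z , ¬w , A'.transitive (A'.symmetric r) (A'.transitive r₀ s)))))))
      (P.A'.symmetric q'))

-- Cyclic successors in a list.

-- Cutting the cycle open gives a path with a free endpoint `z`, which permits induction on the
-- list; the cycle is the case where `z` is the head.
steps : ℕ → List ℕ → ℕ → List (ℕ × ℕ)
steps x []       z = ((x , z) ∷ [])
steps x (y ∷ ys) z = (x , y) ∷ steps y ys z

zip≡steps : ∀ x xs z → zip (x ∷ xs) (xs ++ (z ∷ [])) ≡ steps x xs z
zip≡steps x []       z = refl
zip≡steps x (y ∷ ys) z = cong ((x , y) ∷_) (zip≡steps y ys z)

steps-∷ʳ : ∀ x xs y z → steps x (xs ++ (y ∷ [])) z ≡ steps x xs y ++ ((y , z) ∷ [])
steps-∷ʳ x []       y z = refl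
steps-∷ʳ x (w ∷ ws) y z = cong ((x , w) ∷_) (steps-∷ʳ w ws y z)

steps-source : ∀ {t u} x xs z → (t , u) ∈ steps x xs z → t ∈ x ∷ xs
steps-source x []       z (here refl) = here refl
steps-source x (y ∷ ys) z (here refl) = here refl
steps-source x (y ∷ ys) z (there m)   = there (steps-source y ys z m)

steps-target : ∀ {t u} x xs z → (t , u) ∈ steps x xs z → u ∈ xs ++ (z ∷ [])
steps-target x []       z (here refl) = here refl
steps-target x (y ∷ ys) z (here refl) = here refl
steps-target x (y ∷ ys) z (there m)   = there (steps-target y ys z m)

steps-functional : ∀ {t u v} x xs z → Unique (x ∷ xs) →
  (t , u) ∈ steps x xs z → (t , v) ∈ steps x xs z → u ≡ v
steps-functional x []       z _ (here refl) (here refl) = refl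
steps-functional x (y ∷ ys) z _ (here refl) (here refl) = refl
steps-functional x (y ∷ ys) z (p ∷ _) (here refl) (there m) = ⊥-elim (All.lookup p (steps-source y ys z m) refl)
steps-functional x (y ∷ ys) z (p ∷ _) (there m) (here refl) = ⊥-elim (All.lookup p (steps-source y ys z m) refl)
steps-functional x (y ∷ ys) z (_ ∷ p) (there m) (there n) = steps-functional y ys z p m n

steps-reverse : ∀ {t u} x xs z → (t , u) ∈ steps x xs z → (u , t) ∈ steps z (reverse xs) x
steps-reverse x []       z (here refl) = here refl
steps-reverse x (y ∷ ys) z m rewrite unfold-reverse y ys | steps-∷ʳ z (reverse ys) y x with m
... | here refl = ∈-++⁺ʳ (steps z (reverse ys) y) (here refl)
... | there n   = ∈-++⁺ˡ (steps-reverse y ys z n)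

Next : List ℕ → ℕ → ℕ → Set
Next S t u = (t , u) ∈ zip S (rotate S)

next≡steps : ∀ x xs {t u} → Next (x ∷ xs) t u ≡ ((t , u) ∈ steps x xs x)
next≡steps x xs {t} {u} = cong ((t , u) ∈_) (zip≡steps x xs x)

toSteps : ∀ {x xs t u} → Next (x ∷ xs) t u → (t , u) ∈ steps x xs x
toSteps {x} {xs} = subst (λ A → A) (next≡steps x xs)

fromSteps : ∀ {x xs t u} → (t , u) ∈ steps x xs x → Next (x ∷ xs) t u
fromSteps {x} {xs} = subst (λ A → A) (sym (next≡steps x xs))

nextRotate : ∀ S {t u} → Next (rotate S) t u ⇔ Next S t u
nextRotate [] = mk⇔ (λ n → n) (λ n → n)
nextRotate (x ∷ []) = mk⇔ (λ n → n) (λ n → n)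
nextRotate (x ∷ y ∷ ys) {t} {u} = mk⇔ (fromSteps {x} {y ∷ ys} ∘ f ∘ toSteps) (fromSteps ∘ g ∘ toSteps {x} {y ∷ ys})
  where
  f : (t , u) ∈ steps y (ys ++ (x ∷ [])) y → (t , u) ∈ steps x (y ∷ ys) x
  f m rewrite steps-∷ʳ y ys x y with ∈-++⁻ (steps y ys x) m
  ... | inj₁ n = there n
  ... | inj₂ (here refl) = here refl
  g : (t , u) ∈ steps x (y ∷ ys) x → (t , u) ∈ steps y (ys ++ (x ∷ [])) y
  g m rewrite steps-∷ʳ y ys x y with m
  ... | here refl = ∈-++⁺ʳ (steps y ys x) (here refl)
  ... | there n = ∈-++⁺ˡ n

-- Rotation invariance lets any chosen element be taken as the head of the cycle.
nextSwap : ∀ as bs {t u} → Next (bs ++ as) t u ⇔ Next (as ++ bs) t u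
nextSwap [] bs {t} {u} rewrite ++-identityʳ bs = mk⇔ (λ n → n) (λ n → n)
nextSwap (a ∷ as) bs {t} {u} = nextRotate (a ∷ as ++ bs) ⇔-∘ lemma
  where
  lemma : Next (bs ++ a ∷ as) t u ⇔ Next ((as ++ bs) ++ (a ∷ [])) t u
  lemma rewrite ++-assoc as bs (a ∷ []) | sym (++-assoc bs (a ∷ []) as) = nextSwap as (bs ++ (a ∷ []))

nextReverse⁻ : ∀ S {t u} → Next S t u → Next (reverse S) u t
nextReverse⁻ (x ∷ xs) {t} {u} n = subst (λ L → Next L u t) (sym (unfold-reverse x xs))
  (from (nextRotate (x ∷ reverse xs)) (fromSteps (steps-reverse x xs x (toSteps n))))

nextReverse : ∀ S {t u} → Next (reverse S) t u ⇔ Next S u t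
nextReverse S {t} {u} = mk⇔ (λ n → subst (λ L → Next L u t) (reverse-involutive S) (nextReverse⁻ (reverse S) n))
                            (nextReverse⁻ S)

∈-rotate⁻ : ∀ S {t} → t ∈ rotate S → t ∈ S
∈-rotate⁻ (x ∷ xs) m with ∈-++⁻ xs m
... | inj₁ n = there n
... | inj₂ (here refl) = here refl

next-source : ∀ S {t u} → Next S t u → t ∈ S
next-source (x ∷ xs) n = steps-source x xs x (toSteps n)

next-target : ∀ S {t u} → Next S t u → u ∈ S
next-target (x ∷ xs) n = ∈-rotate⁻ (x ∷ xs) (steps-target x xs x (toSteps n))

next-functional : ∀ S → Unique S → ∀ {t u v} → Next S t u → Next S t v → u ≡ v
next-functional (x ∷ xs) unique m n = steps-functional x xs x unique (toSteps m) (toSteps n)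

walk : ∀ {N : ℕ → ℕ → Set} x xs z → (∀ {t u} → (t , u) ∈ steps x xs z → N t u) →
  ∀ {u} → u ∈ xs ++ (z ∷ []) → TransClosure N x u
walk x []       z sub (here refl) = [ sub (here refl) ]
walk x (y ∷ ys) z sub (here refl) = [ sub (here refl) ]
walk x (y ∷ ys) z sub (there m)   = sub (here refl) ∷ walk y ys z (sub ∘ there) m

uniqueReverse : ∀ {S : List ℕ} → Unique S → Unique (reverse S)
uniqueReverse {[]}     _       = []
uniqueReverse {x ∷ xs} (p ∷ u) = subst Unique (sym (unfold-reverse x xs))
  (Unique.++⁺ (uniqueReverse u) ([] ∷ []) λ { (m , here refl) → All.lookup p (Any.reverse⁻ m) refl })

nextCyclic : ∀ S → Unique S → Cyclic (_∈ S) (Next S)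
nextCyclic S unique = record
  { source     = next-source S
  ; target     = next-target S
  ; functional = next-functional S unique
  -- Predecessors are the successors in the reversed list.
  ; injective  = λ m n → next-functional (reverse S) (uniqueReverse unique) (nextReverse⁻ S m) (nextReverse⁻ S n)
  ; connected  = conn }
  where
  conn : ∀ {t u} → t ∈ S → u ∈ S → TransClosure (Next S) t u
  -- Rotated so that t comes first, the path from t back to t passes through every element, t itself
  -- included.
  conn {t} {u} m n with as , bs , refl ← ∈-∃++ m =
    walk t (bs ++ as) t (λ {v} {w} s → to (nextSwap as (t ∷ bs) {v} {w}) (fromSteps {t} {bs ++ as} s)) member
    where
    member : u ∈ (bs ++ as) ++ (t ∷ [])
    member with ∈-++⁻ as n
    ... | inj₁ k = ∈-++⁺ˡ (∈-++⁺ʳ bs k)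
    ... | inj₂ (here refl) = ∈-++⁺ʳ (bs ++ as) (here refl)
    ... | inj₂ (there k) = ∈-++⁺ˡ (∈-++⁺ˡ k)

module _ (keep : ℕ → Bool) {E : ℕ → Set} {N : ℕ → ℕ → Set} where
  -- x is the last element kept before y; cont extends the run from x to y.
  filteredSteps : ∀ x y xs z → (∀ {t u} → (t , u) ∈ steps y xs z → N t u) →
    (∀ {v} → N y v → Run N E x v) → (∀ {w} → w ∈ xs → ¬ T (keep w) → E w) →
    ∀ {t u} → (t , u) ∈ steps x (filterᵇ keep xs) z → Run N E t u
  filteredSteps x y [] z sub cont drop (here refl) = cont (sub (here refl))
  filteredSteps x y (w ∷ ws) z sub cont drop m with keep w in eq
  filteredSteps x y (w ∷ ws) z sub cont drop (here refl) | true = cont (sub (here refl))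
  filteredSteps x y (w ∷ ws) z sub cont drop (there m) | true =
    filteredSteps w w ws z (sub ∘ there) [_] (drop ∘ there) m
  filteredSteps x y (w ∷ ws) z sub cont drop m | false =
    filteredSteps x w ws z (sub ∘ there) (snocRun (cont (sub (here refl))) (drop (here refl) (subst T eq)))
      (drop ∘ there) m

-- Completeness is deduced from soundness: a kept element has some successor in the filtered list,
-- soundness gives a run to it, and runs from one point to a kept point are unique by
-- `runFunctional`.
nextFilter : ∀ (keep : ℕ → Bool) {E : ℕ → Set} S → Unique S →
  (∀ {t} → t ∈ S → T (keep t) ⇔ (¬ E t)) → (∀ {t} → t ∈ S → ¬ T (keep t) → E t) →
  ∀ {t u} → Next (filterᵇ keep S) t u ⇔ Induced (Next S) E t u
nextFilter keep {E} S unique kept dropped = mk⇔ sound complete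
  where
  C  = nextCyclic S unique
  C' = nextCyclic (filterᵇ keep S) (Unique.filter⁺ (T? ∘ keep) unique)
  survives : ∀ {t} → t ∈ filterᵇ keep S → ¬ E t
  survives m with n , k ← ∈-filter⁻ (T? ∘ keep) {xs = S} m = to (kept n) k
  run : ∀ {t u} → t ∈ S → T (keep t) → Next (filterᵇ keep S) t u → Run (Next S) E t u
  run {t} {u} m k n with as , bs , refl ← ∈-∃++ m = filteredSteps keep t t (bs ++ as) t
      (λ {v} {w} s → to (nextSwap as (t ∷ bs) {v} {w}) (fromSteps {t} {bs ++ as} s))
      [_] (λ w∈ → dropped (swap w∈)) (toSteps {t} {filterᵇ keep (bs ++ as)} n')
    where
    swap : ∀ {w} → w ∈ bs ++ as → w ∈ as ++ t ∷ bs
    swap l with ∈-++⁻ bs l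
    ... | inj₁ l' = ∈-++⁺ʳ as (there l')
    ... | inj₂ l' = ∈-++⁺ˡ l'
    split : filterᵇ keep (as ++ t ∷ bs) ≡ filterᵇ keep as ++ t ∷ filterᵇ keep bs
    split = trans (filter-++ (T? ∘ keep) as (t ∷ bs)) (cong (filterᵇ keep as ++_) (filter-accept (T? ∘ keep) k))
    n' : Next (t ∷ filterᵇ keep (bs ++ as)) t u
    n' = subst (λ L → Next (t ∷ L) t u) (sym (filter-++ (T? ∘ keep) bs as))
           (from (nextSwap (filterᵇ keep as) (t ∷ filterᵇ keep bs)) (subst (λ L → Next L t u) split n))
  sound : ∀ {t u} → Next (filterᵇ keep S) t u → Induced (Next S) E t u
  sound n with m , k ← ∈-filter⁻ (T? ∘ keep) {xs = S} (next-source (filterᵇ keep S) n) =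
    to (kept m) k , survives (next-target (filterᵇ keep S) n) , run m k n
  complete : ∀ {t u} → Induced (Next S) E t u → Next (filterᵇ keep S) t u
  complete {t} {u} (¬t , ¬u , r) with t∈S ← runSource C r
    with u' , n ← Cyclic.successor C' (∈-filter⁺ (T? ∘ keep) t∈S (from (kept t∈S) ¬t))
    with _ , ¬u' , r' ← sound n
    with refl ← runFunctional C ¬u ¬u' r r' = n

-- Lists of blocks as relations.

T-elemℤ : ∀ {x B} → T (elemℤ x B) ⇔ x ∈ B
T-elemℤ {x} {B} = mk⇔ (Any.map toWitness ∘ any⁻ (x ==ℤ_) B) (any⁺ (x ==ℤ_) ∘ Any.map fromWitness)

T-elemℕ : ∀ {t D} → T (elemℕ t D) ⇔ t ∈ D
T-elemℕ {t} {D} = mk⇔ (Any.map toWitness ∘ any⁻ (t ==ℕ_) D) (any⁺ (t ==ℕ_) ∘ Any.map fromWitness)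

T-not : ∀ {b} → T (not b) ⇔ (¬ T b)
T-not {false} = mk⇔ (λ _ ()) (λ _ → _)
T-not {true}  = mk⇔ (λ ()) (λ f → f _)

Together : Partition → ℤ → ℤ → Set
Together P x y = ∃ λ B → B ∈ P × x ∈ B × y ∈ B

anyBlock : ∀ {Q : Block → Set} (q : Block → Bool) {P} → (∀ {B} → T (q B) ⇔ Q B) →
  T (any q P) ⇔ (∃ λ B → B ∈ P × Q B)
anyBlock q {P} e = mk⇔
  (λ p → let B , m , r = find (any⁻ q P p) in B , m , to e r)
  (λ (B , m , r) → any⁺ q (lose m (from e r)))

T-sameBlock : ∀ {P x y} → T (sameBlock P x y) ⇔ Together P x y
T-sameBlock {P} {x} {y} = anyBlock (λ B → elemℤ x B ∧ elemℤ y B)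
  (mk⇔ (λ b → let p , q = to T-∧ b in to T-elemℤ p , to T-elemℤ q)
       (λ (p , q) → from T-∧ (from T-elemℤ p , from T-elemℤ q)))

T-singletonBlock : ∀ {P x} → T (singletonBlock P x) ⇔ (∃ λ B → B ∈ P × x ∈ B × All (_≡ x) B)
T-singletonBlock {P} {x} = anyBlock (λ B → elemℤ x B ∧ all (_==ℤ x) B)
  (λ {B} → mk⇔ (λ b → let p , q = to T-∧ b in to T-elemℤ p , All.map toWitness (all⁺ (_==ℤ x) B q))
       (λ (p , q) → from T-∧ (from T-elemℤ p , all⁻ (_==ℤ x) (All.map fromWitness q))))

togetherSym : ∀ {P x y} → Together P x y → Together P y x
togetherSym (B , m , p , q) = B , m , q , p

sameBlockOf : ∀ {P B C} {x : ℤ} → AllPairs Disjoint P → B ∈ P → C ∈ P → x ∈ B → x ∈ C → B ≡ C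
sameBlockOf (d ∷ ds) (here refl) (here refl) p q = refl
sameBlockOf (d ∷ ds) (here refl) (there n)   p q = ⊥-elim (All.lookup d n (p , q))
sameBlockOf (d ∷ ds) (there m)   (here refl) p q = ⊥-elim (All.lookup d m (q , p))
sameBlockOf (d ∷ ds) (there m)   (there n)   p q = sameBlockOf ds m n p q

togetherTrans : ∀ {P x y z} → AllPairs Disjoint P → Together P x y → Together P y z → Together P x z
togetherTrans d (B , m , p , q) (C , n , r , s) with refl ← sameBlockOf d m n q r = B , m , p , s

-- The relation `Together P` does not see empty or repeated blocks. `inhabited` and `disjoint`
-- exclude both, so that `length P` really counts blocks.
record Valid (S : List ℕ) (P : Partition) : Set where
  field
    inhabited : All (λ B → ∃ (_∈ B)) P
    disjoint  : AllPairs Disjoint P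
    per       : SignedPER (_∈ S) (Together P)

  -- Since - 0 is 0, `antipode` rules out the element zero along with zero-blocks.
  nonzero : ∀ {t} → t ∈ S → t ≢ 0
  nonzero m refl = SignedPER.antipode per (from (SignedPER.domain per {+ 0}) m)

  T-single : ∀ {t} → T (singletonBlock P (+ t)) ⇔ Single (Together P) t
  T-single {t} = mk⇔
    (λ b → let B , m , p , a = to T-singletonBlock b in (B , m , p , p)
         , λ { y (C , n , q , r) → All.lookup a (subst (y ∈_) (sameBlockOf disjoint n m q p) r) })
    (λ { ((B , m , p , _) , s) → from T-singletonBlock
          (B , m , p , All.tabulate λ {y} q → s y (B , m , p , q)) })

  ∈-singletonPairs : ∀ {t} → t ∈ singletonPairs S P ⇔ Single (Together P) t
  ∈-singletonPairs {t} = mk⇔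
    (λ m → to T-single (proj₂ (∈-filter⁻ (T? ∘ λ t → singletonBlock P (+ t)) {xs = S} m)))
    (λ σ → ∈-filter⁺ (T? ∘ λ t → singletonBlock P (+ t)) (SignedPER.inDomain per (proj₁ σ)) (from T-single σ))

∈-adjacencyPairs : ∀ {S P t u} → (t , u) ∈ adjacencyPairs S P ⇔ (Next S t u × Together P (+ t) (+ u))
∈-adjacencyPairs {S} {P} = mk⇔
  (λ m → let n , b = ∈-filter⁻ (T? ∘ _) {xs = zip S (rotate S)} m in n , to T-sameBlock b)
  (λ (n , r) → ∈-filter⁺ (T? ∘ _) n (from T-sameBlock r))

∈-leftPointPairs : ∀ {S P t} → t ∈ leftPointPairs S P ⇔ Left (Next S) (Together P) t
∈-leftPointPairs {S} {P} = mk⇔ sound complete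
  where
  sound : ∀ {t} → t ∈ leftPointPairs S P → Left (Next S) (Together P) t
  sound m with (t , u) , n , refl ← ∈-map⁻ proj₁ m = u , to (∈-adjacencyPairs {S} {P}) n
  complete : ∀ {t} → Left (Next S) (Together P) t → t ∈ leftPointPairs S P
  complete (u , l) = ∈-map⁺ proj₁ (from (∈-adjacencyPairs {S} {P}) l)

-- Blocks correspond by position, each new one being a preimage under `h`. Both operations on
-- partitions have this form: ω, since an involution has equal images and preimages, and attaching,
-- with `h` sending each attached element to its base.
Pulled : (ℤ → ℤ) → Partition → Partition → Set
Pulled h = Pointwise (λ B C → ∀ x → x ∈ C ⇔ h x ∈ B)

pulledBlock : ∀ {h P P' C} → Pulled h P P' → C ∈ P' → ∃ λ B → B ∈ P × (∀ x → x ∈ C ⇔ h x ∈ B)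
pulledBlock (e ∷ es) (here refl) = _ , here refl , e
pulledBlock (e ∷ es) (there m) with B , n , f ← pulledBlock es m = B , there n , f

pulledBlock⁻ : ∀ {h P P' B} → Pulled h P P' → B ∈ P → ∃ λ C → C ∈ P' × (∀ x → x ∈ C ⇔ h x ∈ B)
pulledBlock⁻ (e ∷ es) (here refl) = _ , here refl , e
pulledBlock⁻ (e ∷ es) (there m) with B , n , f ← pulledBlock⁻ es m = B , there n , f

pulledTogether : ∀ {h P P' x y} → Pulled h P P' → Together P' x y ⇔ Together P (h x) (h y)
pulledTogether {x = x} {y} π = mk⇔
  (λ (C , n , p , q) → let B , m , e = pulledBlock π n in B , m , to (e x) p , to (e y) q)
  (λ (B , m , p , q) → let C , n , e = pulledBlock⁻ π m in C , n , from (e x) p , from (e y) q)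

pulledDisjoint : ∀ {h P P'} → Pulled h P P' → AllPairs Disjoint P → AllPairs Disjoint P'
pulledDisjoint [] [] = []
pulledDisjoint (e ∷ es) (d ∷ ds) =
  All.tabulate (λ n (p , q) → let B , m , f = pulledBlock es n in All.lookup d m (to (e _) p , to (f _) q))
  ∷ pulledDisjoint es ds

-- Preimages are requested for elements of `P` only, because the map that describes attaching misses
-- the attached elements.
pulledInhabited : ∀ {h P P'} → Pulled h P P' → (∀ {x} → Together P x x → ∃ λ y → h y ≡ x) →
  All (λ B → ∃ (_∈ B)) P → All (λ B → ∃ (_∈ B)) P'
pulledInhabited π section a = All.tabulate λ n →
  let B , m , e = pulledBlock π n
      x , p     = All.lookup a m
      y , q     = section (B , m , p , p)
  in y , from (e y) (subst (_∈ B) (sym q) p)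

pulledMap : ∀ {h} (g : Block → Block) P → (∀ {B} → B ∈ P → ∀ x → x ∈ g B ⇔ h x ∈ B) → Pulled h P (map g P)
pulledMap g []      e = []
pulledMap g (B ∷ P) e = e (here refl) ∷ pulledMap g P (e ∘ there)

pulledCompose : ∀ {h k l P Q R} → (∀ x → h (k x) ≡ l x) → Pulled h P Q → Pulled k Q R → Pulled l P R
pulledCompose e [] [] = []
pulledCompose e (p ∷ ps) (q ∷ qs) =
  (λ x → mk⇔ (λ m → subst (_∈ _) (e x) (to (p _) (to (q x) m)))
             (λ m → from (q x) (from (p _) (subst (_∈ _) (sym (e x)) m)))) ∷ pulledCompose e ps qs

pulledId : ∀ {h P} → (∀ x → h x ≡ x) → Pulled h P P
pulledId {P = []}    e = []
pulledId {P = B ∷ P} e = (λ x → mk⇔ (subst (_∈ B) (sym (e x))) (subst (_∈ B) (e x))) ∷ pulledId e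

∈-deleteSet : ∀ {D S t} → t ∈ deleteSet D S ⇔ (t ∈ S × t ∉ D)
∈-deleteSet {D} {S} = mk⇔
  (λ m → let n , k = ∈-filter⁻ (T? ∘ λ t → not (elemℕ t D)) {xs = S} m in n , to T-not k ∘ from T-elemℕ)
  (λ (n , k) → ∈-filter⁺ (T? ∘ λ t → not (elemℕ t D)) n (from T-not (k ∘ to T-elemℕ)))

module Deletion {S P} (V : Valid S P) (D : List ℕ) where
  open Valid V
  private
    keepAbs : ℤ → Bool
    keepAbs x = not (elemℕ ∣ x ∣ D)
    cut : Block → Block
    cut = filterᵇ keepAbs

  nonnull : ∀ {B : Block} → T (not (null B)) ⇔ (∃ (_∈ B))
  nonnull {[]}    = mk⇔ (λ ()) (λ ())
  nonnull {x ∷ B} = mk⇔ (λ _ → x , here refl) (λ _ → _)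

  ∈-cut : ∀ {x B} → x ∈ cut B ⇔ (x ∈ B × ∣ x ∣ ∉ D)
  ∈-cut {x} {B} = mk⇔
    (λ m → let n , k = ∈-filter⁻ (T? ∘ keepAbs) {xs = B} m in n , to T-not k ∘ from T-elemℕ)
    (λ (n , k) → ∈-filter⁺ (T? ∘ keepAbs) n (from T-not (k ∘ to T-elemℕ)))

  private
    nonempty? = λ (B : Block) → T? (not (null B))

  deletedTogether : ∀ {x y} → Together (deletePart D P) x y ⇔ (∣ x ∣ ∉ D × ∣ y ∣ ∉ D × Together P x y)
  deletedTogether {x} {y} = mk⇔ sound complete
    where
    sound : Together (deletePart D P) x y → ∣ x ∣ ∉ D × ∣ y ∣ ∉ D × Together P x y
    sound (C , m , p , q) with B , n , refl ← ∈-map⁻ cut (proj₁ (∈-filter⁻ nonempty? {xs = map cut P} m))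
      with p' , ¬x ← to (∈-cut {B = B}) p | q' , ¬y ← to (∈-cut {B = B}) q = ¬x , ¬y , B , n , p' , q'
    complete : ∣ x ∣ ∉ D × ∣ y ∣ ∉ D × Together P x y → Together (deletePart D P) x y
    complete (¬x , ¬y , B , n , p , q) = cut B
      , ∈-filter⁺ nonempty? (∈-map⁺ cut n) (from nonnull (x , from ∈-cut (p , ¬x)))
      , from ∈-cut (p , ¬x) , from ∈-cut (q , ¬y)

  deletedValid : Valid (deleteSet D S) (deletePart D P)
  deletedValid = record
    { inhabited = All.tabulate λ m → to nonnull (proj₂ (∈-filter⁻ nonempty? {xs = map cut P} m))
    ; disjoint  = AllPairs.filter⁺ nonempty? (AllPairs.map⁺ (AllPairs.map cutDisjoint disjoint))
    ; per = record
      { symmetric = togetherSym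
      ; transitive = λ q r → let ¬x , ¬y , q' = to deletedTogether q ; _ , ¬z , r' = to deletedTogether r
                             in from deletedTogether (¬x , ¬z , transitive q' r')
      ; negate = λ {x} {y} q → let ¬x , ¬y , r = to deletedTogether q in from deletedTogether
          (subst (_∉ D) (sym (∣-i∣≡∣i∣ x)) ¬x , subst (_∉ D) (sym (∣-i∣≡∣i∣ y)) ¬y , negate r)
      ; antipode = λ q → antipode (proj₂ (proj₂ (to deletedTogether q)))
      ; domain = mk⇔
          (λ q → let ¬x , _ , r = to deletedTogether q in from ∈-deleteSet (to domain r , ¬x))
          (λ m → let n , ¬x = to ∈-deleteSet m in from deletedTogether (¬x , ¬x , from domain n)) } }
    where
    open SignedPER per
    cutDisjoint : ∀ {B C} → Disjoint B C → Disjoint (cut B) (cut C)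
    cutDisjoint {B} {C} d (p , q) = d (proj₁ (to (∈-cut {B = B}) p) , proj₁ (to (∈-cut {B = C}) q))

-- Cyclic predecessors and the attaching of runs.

before after : List ℕ → ℕ → List ℕ
before S t = takeWhileᵇ (λ u → not (u ==ℕ t)) S
after S t = drop 1 (dropWhileᵇ (λ u → not (u ==ℕ t)) S)

-- cycPred's local search function has no name outside Defs; unification recovers it.
mutual
  firstOut : List ℕ → List ℕ → ℕ → List ℕ → Maybe ℕ
  firstOut = _

  cycPred≡firstOut : ∀ S D t → cycPred S D t ≡ firstOut S D t (reverse (before S t) ++ reverse (after S t))
  cycPred≡firstOut S D t with reverse (takeWhileᵇ (λ u → not (u ==ℕ t)) S)
    ++ reverse (drop 1 (dropWhileᵇ (λ u → not (u ==ℕ t)) S))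
  ... | zs = refl

splitAt : ∀ {t} S → t ∈ S → before S t ++ t ∷ after S t ≡ S
splitAt {t} (x ∷ xs) m with x ≟ t | m
... | yes refl | _         = refl
... | no x≢t | here refl = ⊥-elim (x≢t refl)
... | no x≢t | there n   = cong (x ∷_) (splitAt xs n)

module _ (S D : List ℕ) (t : ℕ) {N : ℕ → ℕ → Set} where
  firstOutRun : ∀ x zs z → (∀ {a b} → (a , b) ∈ steps x zs z → N a b) → ∀ {q} → q ∈ zs → q ∉ D →
    ∃ λ p → firstOut S D t zs ≡ just p × p ∉ D × Run N (_∈ D) x p
  firstOutRun x (u ∷ us) z sub m ¬q with elemℕ u D in eq
  ... | false = u , refl , (λ d → subst T eq (from T-elemℕ d)) , [ sub (here refl) ]
  ... | true with to T-elemℕ (subst T (sym eq) _) | m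
  ...   | u∈D | here refl = ⊥-elim (¬q u∈D)
  ...   | u∈D | there n with p , e , ¬p , r ← firstOutRun u us z (sub ∘ there) n ¬q =
    p , e , ¬p , (sub (here refl) ∷⟨ u∈D ⟩ r)

-- The list searched by `cycPred` is the cycle read backwards from t. The element q outside `D`
-- guarantees that the search succeeds.
cycPredRun : ∀ S D {t q} → t ∈ S → t ∈ D → q ∈ S → q ∉ D →
  ∃ λ p → cycPred S D t ≡ just p × p ∉ D × Run (flip (Next S)) (_∈ D) t p
cycPredRun S D {t} {q} m d n ¬q =
  let p , e , ¬p , r = firstOutRun S D t {flip (Next S)} t zs t sub member ¬q
  in p , trans (cycPred≡firstOut S D t) e , ¬p , r
  where
  as = before S t
  bs = after S t
  zs = reverse as ++ reverse bs
  sub : ∀ {a b} → (a , b) ∈ steps t zs t → Next S b a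
  sub {a} {b} s = subst (λ L → Next L b a) (splitAt S m) (to (nextSwap as (t ∷ bs)) (fromSteps {t} {bs ++ as}
    (subst (λ L → (b , a) ∈ steps t L t)
      (trans (cong reverse (sym (reverse-++ bs as))) (reverse-involutive (bs ++ as)))
      (steps-reverse t zs t s))))
  member : q ∈ zs
  member with ∈-++⁻ as (subst (q ∈_) (sym (splitAt S m)) n)
  ... | inj₁ k = ∈-++⁺ˡ (Any.reverse⁺ k)
  ... | inj₂ (here refl) = ⊥-elim (¬q d)
  ... | inj₂ (there k) = ∈-++⁺ʳ (reverse as) (Any.reverse⁺ k)

-- Adding t to the block of p means pulling the blocks back along this map, as long as t is absent.
hook : ℕ → ℕ → ℕ → ℕ
hook t p u = if does (u ≟ t) then p else u

hook-same : ∀ t p → hook t p t ≡ p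
hook-same t p = cong (if_then p else t) (dec-true (t ≟ t) refl)

hook-other : ∀ {t p u} → u ≢ t → hook t p u ≡ u
hook-other {t} {p} {u} u≢t = cong (if_then p else u) (dec-false (u ≟ t) u≢t)

∈-addBlock : ∀ {p z x : ℤ} {B} → x ∈ (if elemℤ p B then B ++ z ∷ [] else B) ⇔ (x ∈ B ⊎ (x ≡ z × p ∈ B))
∈-addBlock {p} {z} {x} {B} with elemℤ p B in eq
... | true  = mk⇔ f g
  where
  p∈B : p ∈ B
  p∈B = to T-elemℤ (subst T (sym eq) _)
  f : x ∈ B ++ z ∷ [] → x ∈ B ⊎ (x ≡ z × p ∈ B)
  f m with ∈-++⁻ B m
  ... | inj₁ n = inj₁ n
  ... | inj₂ (here e) = inj₂ (e , p∈B)
  g : x ∈ B ⊎ (x ≡ z × p ∈ B) → x ∈ B ++ z ∷ []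
  g (inj₁ n) = ∈-++⁺ˡ n
  g (inj₂ (e , _)) = ∈-++⁺ʳ B (here e)
... | false = mk⇔ inj₁ λ { (inj₁ n) → n ; (inj₂ (_ , n)) → ⊥-elim (subst T eq (from T-elemℤ n)) }

addBlock : ℤ → ℤ → Block → Block
addBlock p z B = if elemℤ p B then B ++ z ∷ [] else B

attachBlock : ℕ → ℕ → Block → Block
attachBlock t p = addBlock (- (+ p)) (- (+ t)) ∘ addBlock (+ p) (+ t)

-- The second addition tests a block that may already contain the new positive element; that element
-- must not be mistaken for `- (+ p)`.
neg≢pos : ∀ p {k} → - (+ p) ≢ + suc k
neg≢pos zero    ()
neg≢pos (suc p) ()

∈-attachBlock⁺ : ∀ {t p B x} → t ≢ 0 →
  x ∈ attachBlock t p B ⇔ (x ∈ B ⊎ (x ≡ + t × + p ∈ B) ⊎ (x ≡ - (+ t) × - (+ p) ∈ B))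
∈-attachBlock⁺ {zero} t≢0 = ⊥-elim (t≢0 refl)
∈-attachBlock⁺ {suc k} {p} {B} {x} _ = mk⇔ f g
  where
  f : x ∈ attachBlock (suc k) p B → x ∈ B ⊎ (x ≡ + suc k × + p ∈ B) ⊎ (x ≡ -[1+ k ] × - (+ p) ∈ B)
  f m with to (∈-addBlock {B = addBlock (+ p) (+ suc k) B}) m
  f m | inj₁ n with to (∈-addBlock {B = B}) n
  ... | inj₁ l = inj₁ l
  ... | inj₂ l = inj₂ (inj₁ l)
  f m | inj₂ (e , n) with to (∈-addBlock {B = B}) n
  ... | inj₁ l = inj₂ (inj₂ (e , l))
  ... | inj₂ (e' , _) = ⊥-elim (neg≢pos p e')
  g : x ∈ B ⊎ (x ≡ + suc k × + p ∈ B) ⊎ (x ≡ -[1+ k ] × - (+ p) ∈ B) → x ∈ attachBlock (suc k) p B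
  g (inj₁ n) = from (∈-addBlock {B = addBlock (+ p) (+ suc k) B}) (inj₁ (from ∈-addBlock (inj₁ n)))
  g (inj₂ (inj₁ n)) = from (∈-addBlock {B = addBlock (+ p) (+ suc k) B}) (inj₁ (from ∈-addBlock (inj₂ n)))
  g (inj₂ (inj₂ (e , n))) =
    from (∈-addBlock {B = addBlock (+ p) (+ suc k) B}) (inj₂ (e , from ∈-addBlock (inj₁ n)))

∈-attachBlock : ∀ {t p B} → t ≢ 0 → + t ∉ B → - (+ t) ∉ B → ∀ x →
  x ∈ attachBlock t p B ⇔ signed (hook t p) x ∈ B
∈-attachBlock {zero} t≢0 _ _ _ = ⊥-elim (t≢0 refl)
∈-attachBlock {suc k} {p} {B} t≢0 ¬t ¬-t (+ u) with u ≟ suc k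
... | yes refl = subst (λ v → + suc k ∈ attachBlock (suc k) p B ⇔ + v ∈ B) (sym (hook-same (suc k) p))
  (mk⇔ (λ { (inj₁ n) → ⊥-elim (¬t n) ; (inj₂ (inj₁ (_ , n))) → n ; (inj₂ (inj₂ (() , _))) })
       (λ n → inj₂ (inj₁ (refl , n))) ⇔-∘ ∈-attachBlock⁺ t≢0)
... | no u≢ = subst (λ v → + u ∈ attachBlock (suc k) p B ⇔ + v ∈ B) (sym (hook-other u≢))
  (mk⇔ (λ { (inj₁ n) → n ; (inj₂ (inj₁ (e , _))) → ⊥-elim (u≢ (+-injective e)) ; (inj₂ (inj₂ (() , _))) })
       inj₁ ⇔-∘ ∈-attachBlock⁺ t≢0)
∈-attachBlock {suc k} {p} {B} t≢0 ¬t ¬-t -[1+ u ] with u ≟ k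
... | yes refl = subst (λ v → -[1+ u ] ∈ attachBlock (suc u) p B ⇔ - (+ v) ∈ B) (sym (hook-same (suc u) p))
  (mk⇔ (λ { (inj₁ n) → ⊥-elim (¬-t n) ; (inj₂ (inj₂ (_ , n))) → n ; (inj₂ (inj₁ (() , _))) })
       (λ n → inj₂ (inj₂ (refl , n))) ⇔-∘ ∈-attachBlock⁺ t≢0)
... | no u≢ = subst (λ v → -[1+ u ] ∈ attachBlock (suc k) p B ⇔ - (+ v) ∈ B) (sym (hook-other (u≢ ∘ suc-injective)))
  (mk⇔ (λ { (inj₁ n) → n ; (inj₂ (inj₂ (refl , _))) → ⊥-elim (u≢ refl) ; (inj₂ (inj₁ (() , _))) })
       inj₁ ⇔-∘ ∈-attachBlock⁺ t≢0)

attachPulled : ∀ {S D t p σ} → cycPred S D t ≡ just p → t ≢ 0 →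
  (∀ {B} → B ∈ σ → + t ∉ B × - (+ t) ∉ B) → Pulled (signed (hook t p)) σ (attach S D t σ)
attachPulled {S} {D} {t} {p} {σ} e t≢0 fresh with cycPred S D t | e
... | _ | refl = subst (Pulled _ σ) (map-∘ σ)
  (pulledMap (attachBlock t p) σ λ m → ∈-attachBlock t≢0 (proj₁ (fresh m)) (proj₂ (fresh m)))

signed-∘ : ∀ {r h l} → r 0 ≡ 0 → (∀ u → r (h u) ≡ l u) → ∀ x → signed r (signed h x) ≡ signed l x
signed-∘ e f (+ n)    = cong (λ z → + z) (f n)
signed-∘ {r} {h} e f -[1+ n ] = trans (signed-neg {r} e (+ h (suc n))) (cong (λ z → - (+ z)) (f (suc n)))

signed-id : ∀ {r} x → r ∣ x ∣ ≡ ∣ x ∣ → signed r x ≡ x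
signed-id (+ n)    e = cong (λ z → + z) e
signed-id -[1+ n ] e = cong (λ z → - (+ z)) e

record Retraction (S D ts : List ℕ) (σ τ : Partition) : Set where
  field
    retract : ℕ → ℕ
    pulled  : Pulled (signed retract) σ τ
    moves   : ∀ {t p} → t ∈ ts → cycPred S D t ≡ just p → retract t ≡ p
    fixes   : ∀ {u} → u ∉ ts → retract u ≡ u

-- Every base p lies in `S'` and is never itself attached. The composed map therefore fixes p and
-- sends each attached element straight to its base, whatever the order of the additions.
foldAttach : ∀ S D ts {S' σ} → Valid S' σ → Unique ts →
  (∀ {t} → t ∈ ts → t ≢ 0 × t ∉ S' × ∃ λ p → cycPred S D t ≡ just p × p ∈ S') →
  Retraction S D ts σ (foldr (attach S D) σ ts)
foldAttach S D [] V u h = record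
  { retract = λ t → t ; pulled = pulledId (λ x → signed-id {λ t → t} x refl)
  ; moves = λ () ; fixes = λ _ → refl }
foldAttach S D (t ∷ ts) {S'} {σ} V (t∉ts ∷ u) h with h (here refl)
... | t≢0 , ¬t , p , e , p∈S' = record
  { retract = retract ∘ hook t p
  ; pulled  = pulledCompose (signed-∘ (fixes 0∉ts) (λ _ → refl)) pulled (attachPulled {S} {D} e t≢0 fresh)
  ; moves   = moves'
  ; fixes   = λ n → trans (cong retract (hook-other (n ∘ here))) (fixes (n ∘ there)) }
  where
  open Retraction (foldAttach S D ts V u (h ∘ there))
  0∉ts : 0 ∉ ts
  0∉ts m = proj₁ (h (there m)) refl
  fix-t : retract t ≡ t
  fix-t = fixes (λ m → All.lookup t∉ts m refl)
  absent : ∀ x → ∣ x ∣ ≡ t → ¬ Together (foldr (attach S D) σ ts) x x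
  absent x refl q = ¬t (subst (_∈ S') (trans (∣signed∣ retract x) fix-t)
    (to (SignedPER.domain (Valid.per V)) (to (pulledTogether pulled) q)))
  fresh : ∀ {B} → B ∈ foldr (attach S D) σ ts → + t ∉ B × - (+ t) ∉ B
  fresh m = (λ n → absent (+ t) refl (_ , m , n , n)) , (λ n → absent (- (+ t)) (∣-i∣≡∣i∣ (+ t)) (_ , m , n , n))
  moves' : ∀ {s q} → s ∈ t ∷ ts → cycPred S D s ≡ just q → retract (hook t p s) ≡ q
  moves' (here refl) e' with refl ← just-injective (trans (sym e) e') =
    trans (cong retract (hook-same t p)) (fixes λ m → proj₁ (proj₂ (h (there m))) p∈S')
  moves' (there m) e' = trans (cong retract (hook-other λ { refl → All.lookup t∉ts m refl })) (moves m e')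

-- Singleton pairs, and a single pair of blocks.

∈-pairs : ∀ L {B} → B ∈ concatMap pairOfSingletons L → ∃ λ x → ∣ x ∣ ∈ L × B ≡ x ∷ []
∈-pairs (t ∷ L) (here refl)         = + t , here refl , refl
∈-pairs (t ∷ L) (there (here refl)) = - (+ t) , here (∣-i∣≡∣i∣ (+ t)) , refl
∈-pairs (t ∷ L) (there (there m)) with x , n , e ← ∈-pairs L m = x , there n , e

∈-pairs⁻ : ∀ L x → ∣ x ∣ ∈ L → (x ∷ []) ∈ concatMap pairOfSingletons L
∈-pairs⁻ (t ∷ L) x (here refl) with signCases x
... | inj₁ e = here (cong (_∷ []) e)
... | inj₂ e = there (here (cong (_∷ []) e))
∈-pairs⁻ (t ∷ L) x (there m) = there (there (∈-pairs⁻ L x m))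

pairsTogether : ∀ {L x y} → Together (concatMap pairOfSingletons L) x y ⇔ (∣ x ∣ ∈ L × x ≡ y)
pairsTogether {L} {x} {y} = mk⇔ f (λ { (m , refl) → x ∷ [] , ∈-pairs⁻ L x m , here refl , here refl })
  where
  f : Together (concatMap pairOfSingletons L) x y → ∣ x ∣ ∈ L × x ≡ y
  f (B , m , p , q) with z , n , refl ← ∈-pairs L m with here refl ← p | here refl ← q = n , refl

pairsInhabited : ∀ L → All (λ B → ∃ (_∈ B)) (concatMap pairOfSingletons L)
pairsInhabited L = All.tabulate λ m → let x , _ , e = ∈-pairs L m in x , subst (x ∈_) (sym e) (here refl)

selfNegative : ∀ x → x ≡ - x → ∣ x ∣ ≡ 0
selfNegative (+ zero) _ = refl

pairsDisjoint : ∀ {L} → Unique L → (∀ {t} → t ∈ L → t ≢ 0) → AllPairs Disjoint (concatMap pairOfSingletons L)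
pairsDisjoint {[]} _ _ = []
pairsDisjoint {t ∷ L} (t∉L ∷ u) nz = (opposite ∷ All.tabulate (other (+ t) refl))
  ∷ All.tabulate (other (- (+ t)) (∣-i∣≡∣i∣ (+ t))) ∷ pairsDisjoint u (nz ∘ there)
  where
  opposite : Disjoint (+ t ∷ []) (- (+ t) ∷ [])
  opposite (here refl , here e) = nz (here refl) (selfNegative (+ t) e)
  other : ∀ x → ∣ x ∣ ≡ t → ∀ {B} → B ∈ concatMap pairOfSingletons L → Disjoint (x ∷ []) B
  other x refl m (here refl , q) with z , n , refl ← ∈-pairs L m with here refl ← q = All.lookup t∉L n refl

fullTogether : ∀ {S x y} → Together (map +_ S ∷ map (λ t → - (+ t)) S ∷ []) x y ⇔
  (∣ x ∣ ∈ S × ∣ y ∣ ∈ S × SameSign x y)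
fullTogether {S} {x} {y} = mk⇔ f g
  where
  f : Together (map +_ S ∷ map (λ t → - (+ t)) S ∷ []) x y → ∣ x ∣ ∈ S × ∣ y ∣ ∈ S × SameSign x y
  f (_ , here refl , p , q) with t , m , refl ← ∈-map⁻ +_ p | u , n , refl ← ∈-map⁻ +_ q =
    m , n , inj₁ (refl , refl)
  f (_ , there (here refl) , p , q) with t , m , refl ← ∈-map⁻ (λ t → - (+ t)) p
    | u , n , refl ← ∈-map⁻ (λ t → - (+ t)) q rewrite ∣-i∣≡∣i∣ (+ t) | ∣-i∣≡∣i∣ (+ u) =
    m , n , inj₂ (refl , refl)
  g : ∣ x ∣ ∈ S × ∣ y ∣ ∈ S × SameSign x y → Together (map +_ S ∷ map (λ t → - (+ t)) S ∷ []) x y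
  g (m , n , inj₁ (p , q)) = _ , here refl
    , subst (_∈ map +_ S) (sym p) (∈-map⁺ +_ m) , subst (_∈ map +_ S) (sym q) (∈-map⁺ +_ n)
  g (m , n , inj₂ (p , q)) = _ , there (here refl)
    , subst (_∈ map (λ t → - (+ t)) S) (sym p) (∈-map⁺ (λ t → - (+ t)) m)
    , subst (_∈ map (λ t → - (+ t)) S) (sym q) (∈-map⁺ (λ t → - (+ t)) n)

pairsValid : ∀ {S} → Unique S → (∀ {t} → t ∈ S → t ≢ 0) → Valid S (concatMap pairOfSingletons S)
pairsValid {S} unique nonzero = record
  { inhabited = pairsInhabited S
  ; disjoint  = pairsDisjoint unique nonzero
  ; per = record
    { symmetric  = togetherSym
    ; transitive = togetherTrans (pairsDisjoint unique nonzero)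
    ; negate     = λ {x} q → let m , e = to (pairsTogether {S}) q in
        from (pairsTogether {S}) (subst (_∈ S) (sym (∣-i∣≡∣i∣ x)) m , cong -_ e)
    ; antipode   = λ {x} q → let m , e = to (pairsTogether {S}) q in nonzero m (selfNegative x e)
    ; domain     = mk⇔ (proj₁ ∘ to (pairsTogether {S})) (λ m → from (pairsTogether {S}) (m , refl)) } }

fullValid : ∀ {S} → ∃ (_∈ S) → (∀ {t} → t ∈ S → t ≢ 0) →
  Valid S (map +_ S ∷ map (λ t → - (+ t)) S ∷ [])
fullValid {S} (t₀ , m₀) nonzero = record
  { inhabited = (_ , ∈-map⁺ +_ m₀) ∷ (_ , ∈-map⁺ (λ t → - (+ t)) m₀) ∷ []
  ; disjoint  = disj
  ; per = record
    { symmetric = togetherSym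
    ; transitive = togetherTrans disj
    ; negate = λ q → from (fullTogether {S}) (neg (to (fullTogether {S}) q))
    ; antipode = λ q → anti (to (fullTogether {S}) q)
    ; domain = λ {x} → mk⇔ (proj₁ ∘ to (fullTogether {S}))
        λ m → from (fullTogether {S}) (m , m , signs x) } }
  where
  signs : ∀ x → SameSign x x
  signs x with signCases x
  ... | inj₁ e = inj₁ (e , e)
  ... | inj₂ e = inj₂ (e , e)
  disj : AllPairs Disjoint (map +_ S ∷ map (λ t → - (+ t)) S ∷ [])
  disj = (apart ∷ []) ∷ [] ∷ []
    where
    apart : Disjoint (map +_ S) (map (λ t → - (+ t)) S)
    apart (p , q) with t , m , refl ← ∈-map⁻ +_ p | u , n , e ← ∈-map⁻ (λ t → - (+ t)) q =
      nonzero m (selfNegative (+ t) (trans e (cong (λ z → - (+ z))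
        (trans (sym (∣-i∣≡∣i∣ (+ u))) (cong ∣_∣ (sym e))))))
  neg : ∀ {x y} → ∣ x ∣ ∈ S × ∣ y ∣ ∈ S × SameSign x y → ∣ - x ∣ ∈ S × ∣ - y ∣ ∈ S × SameSign (- x) (- y)
  neg {x} {y} (m , n , s) rewrite ∣-i∣≡∣i∣ x | ∣-i∣≡∣i∣ y with s
  ... | inj₁ (p , q) = m , n , inj₂ (cong -_ p , cong -_ q)
  ... | inj₂ (p , q) = m , n , inj₁
    (trans (cong -_ p) (neg-involutive _) , trans (cong -_ q) (neg-involutive _))
  anti : ∀ {x} → ¬ (∣ x ∣ ∈ S × ∣ - x ∣ ∈ S × SameSign x (- x))
  anti {x} (m , n , s) rewrite ∣-i∣≡∣i∣ x with s
  ... | inj₁ (p , q) = nonzero m (selfNegative x (trans p (sym q)))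
  ... | inj₂ (p , q) = nonzero m (selfNegative x (trans p (sym q)))

together-++ : ∀ P {Q x y} → Together (P ++ Q) x y ⇔ (Together P x y ⊎ Together Q x y)
together-++ P {Q} {x} {y} = mk⇔ f
  λ { (inj₁ (B , m , r)) → B , ∈-++⁺ˡ m , r ; (inj₂ (B , m , r)) → B , ∈-++⁺ʳ P m , r }
  where
  f : Together (P ++ Q) x y → Together P x y ⊎ Together Q x y
  f (B , m , r) with ∈-++⁻ P m
  ... | inj₁ n = inj₁ (B , n , r)
  ... | inj₂ n = inj₂ (B , n , r)

T-null : ∀ {A : Set} {L : List A} → T (null L) → ∀ {x} → x ∉ L
T-null {L = []} _ ()

¬T-null : ∀ {A : Set} {L : List A} → ¬ T (null L) → ∃ (_∈ L)
¬T-null {L = []}    n = ⊥-elim (n _)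
¬T-null {L = x ∷ L} n = x , here refl

ofTwo : ∀ {A : Set} {L : List A} {x y z} → length L ≡ 2 → x ∈ L → y ∈ L → z ∈ L → x ≡ y ⊎ x ≡ z ⊎ y ≡ z
ofTwo {L = _ ∷ _ ∷ []} _ (here refl) (here refl) _ = inj₁ refl
ofTwo {L = _ ∷ _ ∷ []} _ (there (here refl)) (there (here refl)) _ = inj₁ refl
ofTwo {L = _ ∷ _ ∷ []} _ (here refl) (there (here refl)) (here refl) = inj₂ (inj₁ refl)
ofTwo {L = _ ∷ _ ∷ []} _ (here refl) (there (here refl)) (there (here refl)) = inj₂ (inj₂ refl)
ofTwo {L = _ ∷ _ ∷ []} _ (there (here refl)) (here refl) (here refl) = inj₂ (inj₂ refl)
ofTwo {L = _ ∷ _ ∷ []} _ (there (here refl)) (here refl) (there (here refl)) = inj₂ (inj₁ refl)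

apartBlocks : ∀ {P B C x y} → AllPairs Disjoint P → Disjoint B C → B ∈ P → C ∈ P →
  x ∈ B → y ∈ C → ¬ Together P x y
apartBlocks ds d m n p q (X , k , r , s)
  with refl ← sameBlockOf ds k m r p | refl ← sameBlockOf ds k n s q = d (s , s)

-- Two unrelated elements exclude a single block. Representatives of three blocks would be pairwise
-- unrelated, against the last hypothesis; for a full partition that hypothesis is the pigeonhole on
-- two signs in `amongThree`.
exactlyTwo : ∀ {P x y} → AllPairs Disjoint P → All (λ B → ∃ (_∈ B)) P →
  Together P x x → Together P y y → ¬ Together P x y →
  (∀ {a b c} → Together P a a → Together P b b → Together P c c →
     Together P a b ⊎ Together P a c ⊎ Together P b c) → length P ≡ 2
exactlyTwo {B ∷ []} _ _ (_ , here refl , p , _) (_ , here refl , q , _) n _ = ⊥-elim (n (B , here refl , p , q))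
exactlyTwo {B ∷ C ∷ []} _ _ _ _ _ _ = refl
exactlyTwo {B ∷ C ∷ E ∷ P} ds@((d ∷ e ∷ _) ∷ (f ∷ _) ∷ _) ((b , p) ∷ (c , q) ∷ (_ , r) ∷ _) _ _ _ h
  with h (B , here refl , p , p) (C , there (here refl) , q , q) (E , there (there (here refl)) , r , r)
... | inj₁ t        = ⊥-elim (apartBlocks ds d (here refl) (there (here refl)) p q t)
... | inj₂ (inj₁ t) = ⊥-elim (apartBlocks ds e (here refl) (there (there (here refl))) p r t)
... | inj₂ (inj₂ t) = ⊥-elim (apartBlocks ds f (there (here refl)) (there (there (here refl))) q r t)

sameSign⇒related : ∀ {A R} → SignedPER A R → AllRelated A R → ∀ {x y} → SameSign x y →
  R x x → R y y → R x y
sameSign⇒related {R = R} P full (inj₁ (e , f)) p q =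
  subst₂ R (sym e) (sym f) (full (SignedPER.inDomain P p) (SignedPER.inDomain P q))
sameSign⇒related {R = R} P full (inj₂ (e , f)) p q =
  subst₂ R (sym e) (sym f) (SignedPER.negate P (full (SignedPER.inDomain P p) (SignedPER.inDomain P q)))

amongThree : ∀ {A R} → SignedPER A R → AllRelated A R → ∀ {x y z} → R x x → R y y → R z z →
  R x y ⊎ R x z ⊎ R y z
amongThree P full {x} {y} {z} p q r with signCases x | signCases y | signCases z
... | inj₁ e | inj₁ f | _      = inj₁ (sameSign⇒related P full (inj₁ (e , f)) p q)
... | inj₂ e | inj₂ f | _      = inj₁ (sameSign⇒related P full (inj₂ (e , f)) p q)
... | inj₁ e | inj₂ _ | inj₁ g = inj₂ (inj₁ (sameSign⇒related P full (inj₁ (e , g)) p r))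
... | inj₂ e | inj₁ _ | inj₂ g = inj₂ (inj₁ (sameSign⇒related P full (inj₂ (e , g)) p r))
... | inj₂ _ | inj₁ f | inj₁ g = inj₂ (inj₂ (sameSign⇒related P full (inj₁ (f , g)) q r))
... | inj₁ _ | inj₂ f | inj₂ g = inj₂ (inj₂ (sameSign⇒related P full (inj₂ (f , g)) q r))

-- One step of peeling and patching on lists.

steps-proj₁ : ∀ x xs z → map proj₁ (steps x xs z) ≡ x ∷ xs
steps-proj₁ x []       z = refl
steps-proj₁ x (y ∷ ys) z = cong (x ∷_) (steps-proj₁ y ys z)

-- Each element is the first component of exactly one cyclic pair. Left points thus occur once, and
-- counting adjacency pairs reduces to comparing memberships.
uniqueLeftPoints : ∀ S P → Unique S → Unique (leftPointPairs S P)
uniqueLeftPoints [] P u = []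
uniqueLeftPoints S@(x ∷ xs) P u = AllPairs.map⁺ (AllPairs.filter⁺ (T? ∘ _) (AllPairs.map⁻
  (subst Unique (sym (trans (cong (map proj₁) (zip≡steps x xs x)) (steps-proj₁ x xs x))) u)))

lastStep : ∀ {N D t p} → D t → Run N D t p → ∃ λ d → D d × N d p
lastStep d [ n ]          = _ , d , n
lastStep d (n ∷⟨ e ⟩ r) = lastStep e r

null-++ : ∀ {A : Set} (L : List A) {M} → T (null (L ++ M)) → T (null L ∧ null M)
null-++ [] n = n

module Survivors {S P} (V : Valid S P) (unique : Unique S) (Si Li S' : List ℕ)
    (uniqueSi : Unique Si) (uniqueLi : Unique Li)
    (∈-Si : ∀ {t} → t ∈ Si ⇔ Single (Together P) t)
    (∈-Li : ∀ {t} → t ∈ Li ⇔ Left (Next S) (Together P) t)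
    (∈-S' : ∀ {t} → t ∈ S' ⇔ (t ∈ S × ¬ Deleted (Next S) (Together P) t))
    (deleted? : ∀ t → Dec (Deleted (Next S) (Together P) t))
    (survivor : ∃ λ t → t ∈ S × ¬ Deleted (Next S) (Together P) t)
    {σ} (W : Valid S' σ) where
  open Valid V
  open SignedPER per

  N : ℕ → ℕ → Set
  N = Next S

  R : ℤ → ℤ → Set
  R = Together P

  D : ℕ → Set
  D = Deleted N R

  cyclic : Cyclic (_∈ S) N
  cyclic = nextCyclic S unique

  toLi : ∀ {t} → Left N R t → t ∈ Li
  toLi = from ∈-Li

  fromLi : ∀ {t} → t ∈ Li → Left N R t
  fromLi = to ∈-Li

  noFixedPoint : ∀ {t} → D t → ¬ N t t
  noFixedPoint d n = let v , a , ¬v = survivor in ¬v (subst D (sym (fixedPoint⇒singleton cyclic n a)) d)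

  singleNotLeft : ∀ {t} → t ∈ Si → t ∉ Li
  singleNotLeft m k with σ ← to ∈-Si m | u , n , r ← fromLi k
    with refl ← proj₂ σ _ r = noFixedPoint (inj₁ σ) n

  Si⊆S : ∀ {t} → t ∈ Si → t ∈ S
  Si⊆S = inDomain ∘ proj₁ ∘ to ∈-Si

  Li⊆S : ∀ {t} → t ∈ Li → t ∈ S
  Li⊆S m with u , n , _ ← fromLi m = next-source S n

  -- This justifies that the base t_j of a run belongs to σ_i. It is no singleton by maximality of
  -- the run; nor is it a left point, as it would share a block with the singleton that follows it.
  predecessor : ∀ {t} → t ∈ Si →
    ∃ λ p → cycPred S Si t ≡ just p × p ∉ Si × p ∈ S' × Run (flip N) (_∈ Si) t p
  predecessor {t} m with p , e , ¬p , r ← cycPredRun S Si (Si⊆S m) m (proj₁ (proj₂ survivor))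
      (proj₂ (proj₂ survivor) ∘ inj₁ ∘ to ∈-Si) =
    p , e , ¬p , from ∈-S' (runTarget (flipCyclic cyclic) r , λ
      { (inj₁ σ) → ¬p (from ∈-Si σ) ; (inj₂ l) → notLeft l }) , r
    where
    notLeft : ¬ Left N R p
    notLeft (u , n , q) with d , d∈Si , n' ← lastStep m r with refl ← Cyclic.functional cyclic n n'
      with refl ← proj₂ (to ∈-Si d∈Si) _ (symmetric q) = ¬p d∈Si

  notSi : ∀ {t} → t ∈ S' → t ∉ Si
  notSi m k = proj₂ (to ∈-S' m) (inj₁ (to ∈-Si k))

  notLi : ∀ {t} → t ∈ S' → t ∉ Li
  notLi m k = proj₂ (to ∈-S' m) (inj₂ (fromLi k))

  Q τ : Partition
  Q = foldr (attach S Si) σ Si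
  τ = Q ++ concatMap pairOfSingletons Li

  retraction : Retraction S Si Si σ Q
  retraction = foldAttach S Si Si W uniqueSi λ m →
    let p , e , _ , p∈S' , _ = predecessor m in nonzero (Si⊆S m) , (λ k → notSi k m) , p , e , p∈S'

  open Retraction retraction

  H : ℤ → ℤ
  H = signed retract

  T-Q : ∀ {x y} → Together Q x y ⇔ Together σ (H x) (H y)
  T-Q = pulledTogether pulled

  T-τ : ∀ {x y} → Together τ x y ⇔ (Together Q x y ⊎ (∣ x ∣ ∈ Li × x ≡ y))
  T-τ = mk⇔ (map₂ (to (pairsTogether {Li}))) (map₂ (from (pairsTogether {Li}))) ⇔-∘ together-++ Q

  H-fixes : ∀ {x} → ∣ x ∣ ∈ S' → H x ≡ x
  H-fixes {x} m = signed-id x (fixes (notSi m))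

  H-neg : ∀ x → H (- x) ≡ - H x
  H-neg = signed-neg (fixes (λ m → nonzero (Si⊆S m) refl))

  inQ : ∀ {x y} → Together Q x y → ∣ x ∣ ∈ S' ⊎ ∣ x ∣ ∈ Si
  inQ {x} q with T? (elemℕ ∣ x ∣ Si)
  ... | yes k = inj₂ (to T-elemℕ k)
  ... | no ¬k = inj₁ (subst (_∈ S') (trans (∣signed∣ retract x) (fixes (¬k ∘ from T-elemℕ)))
                  (SignedPER.inDomain (Valid.per W) (to T-Q q)))

  Q-notLi : ∀ {x y} → Together Q x y → ∣ x ∣ ∉ Li
  Q-notLi q with inQ q
  ... | inj₁ m = notLi m
  ... | inj₂ m = singleNotLeft m

  disjointτ : AllPairs Disjoint τ
  disjointτ = AllPairs.++⁺ (pulledDisjoint pulled (Valid.disjoint W))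
    (pairsDisjoint uniqueLi (nonzero ∘ Li⊆S))
    (All.tabulate λ m → All.tabulate λ n (p , q) →
      Q-notLi (_ , m , p , p) (proj₁ (to pairsTogether (_ , n , q , q))))

  validτ : Valid S τ
  validτ = record
    { inhabited = All.++⁺ (pulledInhabited pulled
        (λ {x} q → x , H-fixes (SignedPER.inDomain (Valid.per W) q)) (Valid.inhabited W)) (pairsInhabited Li)
    ; disjoint = disjointτ
    ; per = record
      { symmetric = togetherSym
      ; transitive = togetherTrans disjointτ
      ; negate = λ q → from T-τ (neg (to T-τ q))
      ; antipode = λ q → anti (to T-τ q)
      ; domain = mk⇔ (dom ∘ to T-τ) (from T-τ ∘ dom⁻) } }
    where
    neg : ∀ {x y} → Together Q x y ⊎ (∣ x ∣ ∈ Li × x ≡ y) →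
      Together Q (- x) (- y) ⊎ (∣ - x ∣ ∈ Li × - x ≡ - y)
    neg {x} {y} (inj₁ q) = inj₁ (from T-Q (subst₂ (Together σ) (sym (H-neg x)) (sym (H-neg y))
      (SignedPER.negate (Valid.per W) (to T-Q q))))
    neg {x} (inj₂ (m , e)) = inj₂ (subst (_∈ Li) (sym (∣-i∣≡∣i∣ x)) m , cong -_ e)
    anti : ∀ {x} → ¬ (Together Q x (- x) ⊎ (∣ x ∣ ∈ Li × x ≡ - x))
    anti {x} (inj₁ q) = SignedPER.antipode (Valid.per W) (subst (Together σ (H x)) (H-neg x) (to T-Q q))
    anti {x} (inj₂ (m , e)) = nonzero (Li⊆S m) (selfNegative x e)
    dom : ∀ {x} → Together Q x x ⊎ (∣ x ∣ ∈ Li × x ≡ x) → ∣ x ∣ ∈ S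
    dom (inj₂ (m , _)) = Li⊆S m
    dom (inj₁ q) with inQ q
    ... | inj₁ m = proj₁ (to ∈-S' m)
    ... | inj₂ m = Si⊆S m
    fromS' : ∀ {x} → retract ∣ x ∣ ∈ S' → Together Q x x
    fromS' {x} m = from T-Q (from (SignedPER.domain (Valid.per W))
      (subst (_∈ S') (sym (∣signed∣ retract x)) m))
    dom⁻ : ∀ {x} → ∣ x ∣ ∈ S → Together Q x x ⊎ (∣ x ∣ ∈ Li × x ≡ x)
    dom⁻ {x} m with deleted? ∣ x ∣
    ... | no ¬d = inj₁ (fromS' (subst (_∈ S') (sym (fixes (notSi m'))) m'))
      where
      m' : ∣ x ∣ ∈ S'
      m' = from ∈-S' (m , ¬d)
    ... | yes (inj₂ l) = inj₂ (toLi l , refl)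
    ... | yes (inj₁ s) with k ← from ∈-Si s with p , e , _ , p∈S' , _ ← predecessor k =
      inj₁ (fromS' (subst (_∈ S') (sym (moves k e)) p∈S'))

  -- The code attaches s to the base of its run, the layer asks about the immediate predecessor p.
  -- Both have the same base: a backward run from p, prolonged by s, is a backward run from s, and
  -- `runFunctional` identifies the endpoints. If p is no singleton, it is the base.
  attachedτ : ∀ {p s} → N p s → Single R s → Together τ (+ p) (+ s)
  attachedτ {p} {s} n δ with k ← from ∈-Si δ with q , e , ¬q , q∈S' , run ← predecessor k =
    from T-τ (inj₁ (from T-Q (subst₂ (λ a b → Together σ (+ a) (+ b)) (sym (same (T? (elemℕ p Si))))
      (sym (moves k e)) (from (SignedPER.domain (Valid.per W) {+ q}) q∈S'))))
    where
    same : Dec (T (elemℕ p Si)) → retract p ≡ q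
    same (yes j) with q' , e' , ¬q' , _ , run' ← predecessor (to T-elemℕ j) =
      trans (moves (to T-elemℕ j) e')
        (runFunctional (flipCyclic cyclic) ¬q' ¬q (n ∷⟨ to T-elemℕ j ⟩ run') run)
    same (no ¬j) = trans (fixes (¬j ∘ from T-elemℕ))
      (runFunctional {D = _∈ Si} (flipCyclic cyclic) (¬j ∘ from T-elemℕ) ¬q [ n ] run)

  layer : ∀ {N₁ R₁} → (∀ {t u} → N₁ t u ⇔ Induced N D t u) → (∀ {x y} → R₁ x y ⇔ Restrict R D x y) →
    ∃ D → Layer (_∈ S) N R (Together τ) N₁ R₁ (Together σ)
  layer next inner (t , d) = record
    { decide   = λ t _ → deleted? t
    ; deleted  = t , deletedInDomain cyclic per d , d
    ; survivor = survivor
    ; next     = next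
    ; inner    = inner
    ; inner'   = mk⇔ into out
    ; isolate  = λ {t} l → from T-τ (inj₂ (toLi l , refl)) , λ y q → alone l (to T-τ q)
    ; attached = attachedτ }
    where
    into : ∀ {x y} → Together σ x y → Restrict (Together τ) D x y
    into q with m ← SignedPER.inDomain (Valid.per W) q | k ← SignedPER.inDomainʳ (Valid.per W) q =
      proj₂ (to ∈-S' m) , proj₂ (to ∈-S' k)
      , from T-τ (inj₁ (from T-Q (subst₂ (Together σ) (sym (H-fixes m)) (sym (H-fixes k)) q)))
    out : ∀ {x y} → Restrict (Together τ) D x y → Together σ x y
    out {x} {y} (¬x , ¬y , q) with to T-τ q
    ... | inj₂ (m , _) = ⊥-elim (¬x (inj₂ (fromLi m)))
    ... | inj₁ r = subst₂ (Together σ)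
      (signed-id x (fixes (¬x ∘ inj₁ ∘ to ∈-Si)))
      (signed-id y (fixes (¬y ∘ inj₁ ∘ to ∈-Si))) (to T-Q r)
    alone : ∀ {t y} → Left N R t → Together Q (+ t) y ⊎ (t ∈ Li × + t ≡ y) → y ≡ + t
    alone l (inj₁ q)       = ⊥-elim (Q-notLi q (toLi l))
    alone l (inj₂ (_ , e)) = sym e

module _ {S P} (V : Valid S P) where
  open Valid V
  open SignedPER per

  -- This settles the overlap of the two collapse cases. Among the blocks of t, - t and u two
  -- coincide; those of t and - t cannot, and a coincidence of the other two pairs relates t to u or
  -- forces u and t to be equal.
  twoBlocks⇒related : length P ≡ 2 → AllSingle (_∈ S) (Together P) → AllRelated (_∈ S) (Together P)
  twoBlocks⇒related e single {t} {u} m n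
    with X , x , p , _ ← from (domain {+ t}) m
       | Y , y , q , _ ← negate (from (domain {+ t}) m)
       | Z , z , r , _ ← from (domain {+ u}) n with ofTwo e x y z
  ... | inj₁ refl        = ⊥-elim (antipode (X , x , p , q))
  ... | inj₂ (inj₁ refl) = X , x , p , r
  ... | inj₂ (inj₂ refl) = subst (λ v → Together P (+ t) (+ v)) (sym u≡t) (from (domain {+ t}) m)
    where
    u≡t : u ≡ t
    u≡t = trans (cong ∣_∣ (PER.signedSingle per
      (subst (Single (Together P)) (sym (∣-i∣≡∣i∣ (+ t))) (single m)) (Y , y , q , r))) (∣-i∣≡∣i∣ (+ t))

  related⇒twoBlocks : ∃ (_∈ S) → AllRelated (_∈ S) (Together P) → length P ≡ 2
  related⇒twoBlocks (t , m) full = exactlyTwo disjoint inhabited (from (domain {+ t}) m)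
    (negate (from (domain {+ t}) m)) antipode (amongThree per full)

  module Patching (unique : Unique S) where
    N : ℕ → ℕ → Set
    N = Next S

    D : ℕ → Set
    D = Deleted N (Together P)

    Si Li S' : List ℕ
    Si = singletonPairs S P
    Li = leftPointPairs S P
    S' = deleteSet (Si ++ Li) S

    P' : Partition
    P' = deletePart (Si ++ Li) P

    cyclic : Cyclic (_∈ S) N
    cyclic = nextCyclic S unique

    ∈-deleted : ∀ {t} → t ∈ Si ++ Li ⇔ D t
    ∈-deleted = mk⇔
      (λ m → [ inj₁ ∘ to ∈-singletonPairs , inj₂ ∘ to (∈-leftPointPairs {S} {P}) ]′ (∈-++⁻ Si m))
      [ ∈-++⁺ˡ ∘ from ∈-singletonPairs , ∈-++⁺ʳ Si ∘ from (∈-leftPointPairs {S} {P}) ]′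

    deleted? : ∀ t → Dec (D t)
    deleted? t = Dec.map′ (to ∈-deleted ∘ to T-elemℕ) (from T-elemℕ ∘ from ∈-deleted) (T? (elemℕ t (Si ++ Li)))

    V' : Valid S' P'
    V' = Deletion.deletedValid V (Si ++ Li)

    unique' : Unique S'
    unique' = Unique.filter⁺ _ unique

    shrinks : ∃ D → length S' < length S
    shrinks (t , d) = filter-notAll _ S
      (lose (deletedInDomain cyclic per d) λ k → to T-not k (from T-elemℕ (from ∈-deleted d)))

    ∈-S' : ∀ {t} → t ∈ S' ⇔ (t ∈ S × ¬ D t)
    ∈-S' = mk⇔ (λ m → let n , k = to (∈-deleteSet {Si ++ Li}) m in n , k ∘ from ∈-deleted)
               (λ (n , k) → from (∈-deleteSet {Si ++ Li}) (n , k ∘ to ∈-deleted))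

    -- By `allDeleted` only two shapes remain, and counting blocks separates them: a full partition
    -- has exactly two blocks, and a discrete one with two blocks is also full.
    finish : ∃ (_∈ S) → (∀ {t} → t ∈ S → D t) →
      let τ = if length P ==ℕ 2 then concatMap pairOfSingletons S else map +_ S ∷ map (λ t → - (+ t)) S ∷ []
      in Valid S τ × Psi (_∈ S) N (Together P) (Together τ)
    finish a del with length P ≟ 2 | allDeleted cyclic per a del
    ... | yes e | r = W , collapse frame₀ a (inj₁ (related r , λ m → from (pairsTogether {S}) (m , refl)
            , λ y q → sym (proj₂ (to (pairsTogether {S}) q))))
      where
      W = pairsValid unique nonzero
      frame₀ = record { cyclic = cyclic ; before = per ; after = Valid.per W }
      related : AllRelated (_∈ S) (Together P) ⊎ AllSingle (_∈ S) (Together P) → AllRelated (_∈ S) (Together P)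
      related (inj₁ full)   = full
      related (inj₂ single) = twoBlocks⇒related e single
    ... | no ¬e | inj₁ full = ⊥-elim (¬e (related⇒twoBlocks a full))
    ... | no ¬e | inj₂ single = W , collapse frame₀ a (inj₂ (single
            , λ m n → from (fullTogether {S}) (m , n , inj₁ (refl , refl))))
      where
      W = fullValid a nonzero
      frame₀ = record { cyclic = cyclic ; before = per ; after = Valid.per W }

    nextDeleted : ∀ {t u} → Next S' t u ⇔ Induced N D t u
    nextDeleted = nextFilter (λ t → not (elemℕ t (Si ++ Li))) S unique
      (λ _ → mk⇔ (λ k → to T-not k ∘ from T-elemℕ ∘ from ∈-deleted)
                 (λ ¬d → from T-not (¬d ∘ to ∈-deleted ∘ to T-elemℕ)))
      (λ {t} _ k → Dec.decidable-stable (deleted? t) λ ¬d → k (from T-not (¬d ∘ to ∈-deleted ∘ to T-elemℕ)))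

    restrictDeleted : ∀ {x y} → Together P' x y ⇔ Restrict (Together P) D x y
    restrictDeleted = mk⇔
      (λ q → let ¬x , ¬y , r = to deletedTogether q in ¬x ∘ from ∈-deleted , ¬y ∘ from ∈-deleted , r)
      (λ (¬x , ¬y , r) → from deletedTogether (¬x ∘ to ∈-deleted , ¬y ∘ to ∈-deleted , r))
      where open Deletion V (Si ++ Li) using (deletedTogether)

    -- The induction hypothesis is conditional on `∃ D` because only a deletion makes the underlying
    -- set shorter, as the fuel bound requires.
    realiseStep : ∀ σ → (∃ D → Valid S' σ × Psi (_∈ S') (Next S') (Together P') (Together σ)) →
      let τ = if null Si ∧ null Li then P else patch S P Si Li S' σ
      in Valid S τ × Psi (_∈ S) N (Together P) (Together τ)
    realiseStep σ ih with null Si ∧ null Li in eq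
    ... | true = V , stop (record { cyclic = cyclic ; before = per ; after = per })
        (λ t d → [ T-null (proj₁ none) , T-null (proj₂ none) ]′ (∈-++⁻ Si (from ∈-deleted d)))
        (mk⇔ (λ r → r) (λ r → r))
      where
      none : T (null Si) × T (null Li)
      none = to T-∧ (subst T (sym eq) _)
    ... | false = peelOrCollapse
      where
      some : ∃ D
      some = let t , m = ¬T-null {L = Si ++ Li} (subst T eq ∘ null-++ Si) in t , to ∈-deleted m
      peelOrCollapse : let τ = patch S P Si Li S' σ in Valid S τ × Psi (_∈ S) N (Together P) (Together τ)
      peelOrCollapse with null S' in eq'
      ... | true = finish (proj₁ some , deletedInDomain cyclic per (proj₂ some))
            λ {t} m → Dec.decidable-stable (deleted? t) λ ¬d →
              T-null {L = S'} (subst T (sym eq') _) (from ∈-S' (m , ¬d))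
      ... | false = validτ , peel
              (record { cyclic = cyclic ; before = per ; after = Valid.per validτ }) 
              (layer nextDeleted restrictDeleted some) (proj₂ (ih some))
        where
        survivor : ∃ λ t → t ∈ S × ¬ D t
        survivor = let t , m = ¬T-null {L = S'} (subst T eq') in t , to ∈-S' m
        open Survivors V unique Si Li S' (Unique.filter⁺ _ unique) (uniqueLeftPoints S P unique)
          ∈-singletonPairs (∈-leftPointPairs {S} {P}) ∈-S' deleted? survivor (proj₁ (ih some)) using (validτ; layer)

realise : ∀ f S P → Unique S → Valid S P → length S < f →
  Valid S (psiAux f S P) × Psi (_∈ S) (Next S) (Together P) (Together (psiAux f S P))
realise (suc f) S P unique V (s≤s S≤f) = realiseStep (psiAux f S' P')
    λ d → realise f S' P' unique' V' (≤-trans (shrinks d) S≤f)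
  where open Patching V unique

-- The complement ω as a reversal of the cyclic order.

steps-map : ∀ (f : ℕ → ℕ) x xs z {t u} → (t , u) ∈ steps x xs z → (f t , f u) ∈ steps (f x) (map f xs) (f z)
steps-map f x []       z (here refl) = here refl
steps-map f x (y ∷ ys) z (here refl) = here refl
steps-map f x (y ∷ ys) z (there m)   = there (steps-map f y ys z m)

next-map : ∀ (f : ℕ → ℕ) S {t u} → Next S t u → Next (map f S) (f t) (f u)
next-map f (x ∷ xs) n = fromSteps (steps-map f x xs x (toSteps n))

unique-posRange : ∀ n → Unique (posRange n)
unique-posRange n = Unique.map⁺ suc-injective (Unique.upTo⁺ n)

length-posRange : ∀ n → length (posRange n) ≡ n
length-posRange n = trans (length-map suc (upTo n)) (length-upTo n)

∈-posRange : ∀ {n t} → t ∈ posRange n ⇔ (t ≢ 0 × t ≤ n)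
∈-posRange {n} = mk⇔ f g
  where
  f : ∀ {t} → t ∈ posRange n → t ≢ 0 × t ≤ n
  f m with k , l , refl ← ∈-map⁻ suc m = (λ ()) , ∈-upTo⁻ l
  g : ∀ {t} → t ≢ 0 × t ≤ n → t ∈ posRange n
  g {zero}  (t≢0 , _) = ⊥-elim (t≢0 refl)
  g {suc k} (_ , l)   = ∈-map⁺ suc (∈-upTo⁺ l)

inRange⇔ : ∀ {n x} → InRange n x ⇔ ∣ x ∣ ∈ posRange n
inRange⇔ = mk⇔ (λ (x≢0 , l) → from ∈-posRange ((λ e → x≢0 (∣i∣≡0⇒i≡0 e)) , l))
               (λ m → let t≢0 , l = to ∈-posRange m in (λ { refl → t≢0 refl }) , l)

-- This is k to n + 1 - k on 1, ..., n, written with `suc k` for k, and the identity elsewhere. The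
-- formula of `ωElem` moves zero and truncates above n, so only this variant is an involution on all
-- of ℕ.
flipTo : ℕ → ℕ → ℕ
flipTo n zero    = zero
flipTo n (suc k) = if does (k <? n) then n ∸ k else suc k

flipTo-in : ∀ {n k} → k < n → flipTo n (suc k) ≡ n ∸ k
flipTo-in {n} {k} l = cong (if_then n ∸ k else suc k) (dec-true (k <? n) l)

flipTo-out : ∀ {n k} → ¬ (k < n) → flipTo n (suc k) ≡ suc k
flipTo-out {n} {k} l = cong (if_then n ∸ k else suc k) (dec-false (k <? n) l)

∸-suc : ∀ {n k} → k < n → n ∸ k ≡ suc (n ∸ suc k)
∸-suc = +-∸-assoc 1

∸-suc< : ∀ {n k} → k < n → n ∸ suc k < n
∸-suc< {suc n} {k} _ = s≤s (m∸n≤m n k)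

flipTo-involutive : ∀ n t → flipTo n (flipTo n t) ≡ t
flipTo-involutive n zero = refl
flipTo-involutive n (suc k) = go (k <? n)
  where
  go : Dec (k < n) → flipTo n (flipTo n (suc k)) ≡ suc k
  go (yes l) = trans (cong (flipTo n) (trans (flipTo-in l) (∸-suc l))) (trans (flipTo-in (∸-suc< l)) (m∸[m∸n]≡n l))
  go (no ¬l) = trans (cong (flipTo n) (flipTo-out ¬l)) (flipTo-out ¬l)

reversal : ℕ → Relabelling
reversal n = record { c = flipTo n ; involutive = flipTo-involutive n ; fixesZero = refl }

-- Applying ω to the positive elements reverses their list; this identity is the source of the
-- reversal of `Next`.
reverse-posRange : ∀ n → reverse (posRange n) ≡ map (flipTo n) (posRange n)
reverse-posRange n = begin
  reverse (map suc (upTo n))        ≡⟨ reverse-map suc (upTo n) ⟨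
  map suc (reverse (upTo n))        ≡⟨ cong (map suc) (reverse-upTo n) ⟩
  map suc (downFrom n)              ≡⟨ map-downFrom suc n ⟩
  applyDownFrom suc n               ≡⟨ countdown n ⟨
  applyUpTo (n ∸_) n                ≡⟨ map-upTo (n ∸_) n ⟨
  map (n ∸_) (upTo n)               ≡⟨ map-cong-local (All.map (sym ∘ flipTo-in) (all-upTo n)) ⟩
  map (flipTo n ∘ suc) (upTo n)     ≡⟨ map-∘ (upTo n) ⟩
  map (flipTo n) (posRange n)       ∎
  where
  open ≡-Reasoning
  countdown : ∀ n → applyUpTo (n ∸_) n ≡ applyDownFrom suc n
  countdown zero    = refl
  countdown (suc n) = cong (suc n ∷_) (countdown n)

module Reversal (n : ℕ) where
  open Relabelling (reversal n) public

  S : List ℕ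
  S = posRange n

  nextReversed : ∀ {t u} → Next S t u → Next S (c u) (c t)
  nextReversed {t} {u} m = to (nextReverse S)
    (subst (λ L → Next L (c t) (c u)) (sym (reverse-posRange n)) (next-map c S m))

  nextIso : NextIso (Next S) (flip (Next S))
  nextIso .NextIso.at {t} {u} = mk⇔ nextReversed
    λ m → subst₂ (Next S) (involutive t) (involutive u) (nextReversed m)

  c-range : ∀ {t} → t ∈ S → c t ∈ S
  c-range {t} m = Any.reverse⁻ (subst (c t ∈_) (sym (reverse-posRange n)) (∈-map⁺ c m))

  ωElem≡ĉ : ∀ x → ∣ x ∣ ∈ S → ωElem n x ≡ ĉ x
  ωElem≡ĉ x m with x | to ∈-posRange m
  ... | + zero   | 0≢0 , _ = ⊥-elim (0≢0 refl)
  ... | + suc k  | _ , l   = cong (λ t → + t) (sym (flipTo-in l))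
  ... | -[1+ k ] | _ , l   = cong (λ t → - (+ t)) (sym (flipTo-in l))

  module _ {P : Partition} (V : Valid S P) where
    open Valid V
    open SignedPER per

    ∈-ωBlock : ∀ {B} → B ∈ P → ∀ x → x ∈ map (ωElem n) B ⇔ ĉ x ∈ B
    ∈-ωBlock {B} m x = mk⇔ f g
      where
      agree : ∀ {z} → z ∈ B → ωElem n z ≡ ĉ z
      agree {z} q = ωElem≡ĉ z (inDomain (B , m , q , q))
      f : x ∈ map (ωElem n) B → ĉ x ∈ B
      f p with z , q , refl ← ∈-map⁻ (ωElem n) p =
        subst (_∈ B) (sym (trans (cong ĉ (agree q)) (ĉ-involutive z))) q
      g : ĉ x ∈ B → x ∈ map (ωElem n) B
      g q = subst (_∈ map (ωElem n) B) (trans (agree q) (ĉ-involutive x)) (∈-map⁺ (ωElem n) q)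

    ωPulled : Pulled ĉ P (ω n P)
    ωPulled = pulledMap (map (ωElem n)) P ∈-ωBlock

    ωTogether : ∀ {x y} → Together (ω n P) x y ⇔ Together P (ĉ x) (ĉ y)
    ωTogether = pulledTogether ωPulled

    ωPERIso : PERIso (Together (ω n P)) (Together P)
    ωPERIso .PERIso.at = ωTogether

    ωValid : Valid S (ω n P)
    ωValid = record
      { inhabited = pulledInhabited ωPulled (λ {x} _ → ĉ x , ĉ-involutive x) inhabited
      ; disjoint  = ωDisjoint
      ; per = record
        { symmetric  = togetherSym
        ; transitive = togetherTrans ωDisjoint
        ; negate     = λ {x} {y} q → from ωTogether (subst₂ (Together P) (sym (ĉ-neg x)) (sym (ĉ-neg y))
            (negate (to ωTogether q)))
        ; antipode   = λ {x} q → antipode (subst (Together P (ĉ x)) (ĉ-neg x) (to ωTogether q))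
        ; domain     = λ {x} → mk⇔
            (λ q → subst (_∈ S) (trans (cong c (∣ĉ∣ x)) (involutive ∣ x ∣)) (c-range (inDomain (to ωTogether q))))
            (λ m → from ωTogether (from domain (subst (_∈ S) (sym (∣ĉ∣ x)) (c-range m)))) } }
      where
      ωDisjoint : AllPairs Disjoint (ω n P)
      ωDisjoint = pulledDisjoint ωPulled disjoint

-- Translation between `IsV` and `Valid`.

-- A later block sharing x with the head would raise the count for x to two. The tail inherits the
-- bound, as dropping a block cannot increase a count.
countOne⇒disjoint : ∀ P → (∀ {B x} → B ∈ P → x ∈ B → length (filterᵇ (elemℤ x) P) ≤ 1) → AllPairs Disjoint P
countOne⇒disjoint []      _ = []
countOne⇒disjoint (B ∷ P) h = All.tabulate apart ∷ countOne⇒disjoint P tail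
  where
  grow : ∀ x → length (filterᵇ (elemℤ x) P) ≤ length (filterᵇ (elemℤ x) (B ∷ P))
  grow x with elemℤ x B
  ... | true  = n≤1+n _
  ... | false = ≤-refl
  tail : ∀ {C x} → C ∈ P → x ∈ C → length (filterᵇ (elemℤ x) P) ≤ 1
  tail {x = x} m p = ≤-trans (grow x) (h (there m) p)
  apart : ∀ {C} → C ∈ P → Disjoint B C
  apart {C} m {x} (p , q) with elemℤ x B in eq | h (here refl) p
  ... | false | _ = subst T eq (from T-elemℤ p)
  ... | true  | s≤s l with filterᵇ (elemℤ x) P | ∈-filter⁺ (T? ∘ elemℤ x) m (from T-elemℤ q) | l
  ...   | _ ∷ _ | _ | ()

disjoint⇒countOne : ∀ {P B x} → AllPairs Disjoint P → B ∈ P → x ∈ B → length (filterᵇ (elemℤ x) P) ≡ 1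
disjoint⇒countOne {B ∷ P} {x = x} (d ∷ ds) (here refl) p = cong length
  (trans (filter-accept (T? ∘ elemℤ x) {B} {P} (from T-elemℤ p)) (cong (B ∷_)
    (filter-none (T? ∘ elemℤ x) (All.map (λ e q → e (p , to T-elemℤ q)) d))))
disjoint⇒countOne {B ∷ P} {x = x} (d ∷ ds) (there m) p = trans
  (cong length (filter-reject (T? ∘ elemℤ x) {B} {P} (λ q → All.lookup d m (to T-elemℤ q , p))))
  (disjoint⇒countOne ds m p)

isV⇒valid : ∀ {n P} → IsV n P → Valid (posRange n) P
isV⇒valid {n} {P} I = record
  { inhabited = All.tabulate λ {B} m → inhabit B (nonempty B m)
  ; disjoint  = disj
  ; per = record
    { symmetric = togetherSym
    ; transitive = togetherTrans disj
    ; negate = λ { (B , m , p , q) → let C , k , _ , e = symmetric B m in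
        C , k , e _ (∈-map⁺ -_ p) , e _ (∈-map⁺ -_ q) }
    ; antipode = anti
    ; domain = λ {x} → mk⇔ (λ (B , m , p , _) → to inRange⇔ (inRange B x m p)) (dom x) } }
  where
  open IsV I
  inhabit : ∀ (B : Block) → B ≢ [] → ∃ (_∈ B)
  inhabit []      n = ⊥-elim (n refl)
  inhabit (x ∷ B) _ = x , here refl
  disj : AllPairs Disjoint P
  disj = countOne⇒disjoint P λ {B} {x} m p → ≤-reflexive (covers x (inRange B x m p))
  anti : ∀ {x} → ¬ Together P x (- x)
  anti {x} (B , m , p , q) with C , k , e , e' ← symmetric B m
    with refl ← sameBlockOf disj m k q (e' _ (∈-map⁺ -_ p)) = noZero B m (e , e')
  dom : ∀ x → ∣ x ∣ ∈ posRange n → Together P x x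
  dom x m with filterᵇ (elemℤ x) P in eq | covers x (from inRange⇔ m)
  ... | B ∷ _ | _ with k , q ← ∈-filter⁻ (T? ∘ elemℤ x) {xs = P} (subst (B ∈_) (sym eq) (here refl)) =
    B , k , to T-elemℤ q , to T-elemℤ q

valid⇒isV : ∀ {n P} → Valid (posRange n) P → IsV n P
valid⇒isV {n} {P} V = record
  { nonempty  = λ { B m refl → noElement (proj₂ (All.lookup inhabited m)) }
  ; inRange   = λ B x m p → from inRange⇔ (inDomain (B , m , p , p))
  ; covers    = λ x r → let B , m , p , _ = from domain (to inRange⇔ r) in disjoint⇒countOne disjoint m p
  ; symmetric = opposite
  ; noZero    = λ B m (e , _) → let x , p = All.lookup inhabited m
                                    z , q , x≡-z = ∈-map⁻ -_ (e x p)
                                in antipode (B , m , q , subst (_∈ B) x≡-z p) }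
  where
  open Valid V
  open SignedPER per
  noElement : ∀ {x : ℤ} → x ∉ []
  noElement ()
  opposite : ∀ B → B ∈ P → ∃ λ C → C ∈ P × BlockEq C (negBlock B)
  opposite B m with x , p ← All.lookup inhabited m with C , k , q , _ ← negate (B , m , p , p) =
    C , k , sub , sup
    where
    sub : ∀ y → y ∈ C → y ∈ negBlock B
    sub y r with D , l , s , t ← negate (C , k , q , r)
      with refl ← sameBlockOf disjoint l m (subst (_∈ D) (neg-involutive x) s) p =
      subst (_∈ negBlock B) (neg-involutive y) (∈-map⁺ -_ t)
    sup : ∀ y → y ∈ negBlock B → y ∈ C
    sup y r with z , l , refl ← ∈-map⁻ -_ r with D , j , s , t ← negate (B , m , p , l)
      with refl ← sameBlockOf disjoint j k s q = t

sameTogether⇒PartEq : ∀ {S P Q} → Valid S P → Valid S Q →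
  (∀ {x y} → Together P x y ⇔ Together Q x y) → PartEq P Q
sameTogether⇒PartEq V W e = match V W e
  , λ C m → let B , k , f , g = match W V (mk⇔ (from e) (to e)) C m in B , k , g , f
  where
  match : ∀ {S P Q} → Valid S P → Valid S Q → (∀ {x y} → Together P x y ⇔ Together Q x y) →
    ∀ B → B ∈ P → ∃ λ C → C ∈ Q × BlockEq B C
  match V W e B m with x , p ← All.lookup (Valid.inhabited V) m with C , k , q , _ ← to e (B , m , p , p) =
    C , k , sub , sup
    where
    sub : ∀ y → y ∈ B → y ∈ C
    sub y r with D , l , s , t ← to e (B , m , p , r) with refl ← sameBlockOf (Valid.disjoint W) l k s q = t
    sup : ∀ y → y ∈ C → y ∈ B
    sup y r with D , l , s , t ← from e (C , k , q , r) with refl ← sameBlockOf (Valid.disjoint V) l m s p = t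

-- Counting, and the involution.

-- Duplicate-free lists with the same members are permutations of each other; this is applied to
-- `xs` and the image of `ys` under the involution `c`.
sameLength : ∀ {c : ℕ → ℕ} {xs ys} → (∀ t → c (c t) ≡ t) → Unique xs → Unique ys →
  (∀ {t} → t ∈ xs ⇔ c t ∈ ys) → length xs ≡ length ys
sameLength {c} {xs} {ys} inv ux uy e = trans
  (↭-length (∼bag⇒↭ (unique∧set⇒bag ux (Unique.map⁺ c-injective uy) (mk⇔ f g))))
  (length-map c ys)
  where
  c-injective : ∀ {t u} → c t ≡ c u → t ≡ u
  c-injective {t} {u} p = trans (sym (inv t)) (trans (cong c p) (inv u))
  f : ∀ {t} → t ∈ xs → t ∈ map c ys
  f {t} m = subst (_∈ map c ys) (inv t) (∈-map⁺ c (to e m))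
  g : ∀ {t} → t ∈ map c ys → t ∈ xs
  g m with u , k , refl ← ∈-map⁻ c m = from e (subst (_∈ ys) (sym (inv u)) k)

module Involution {n π σ τ} (V : Valid (posRange n) π) (Vσ : Valid (posRange n) σ) (Vτ : Valid (posRange n) τ)
    (Ψ₁ : Psi (_∈ posRange n) (Next (posRange n)) (Together π) (Together σ))
    (Ψ₂ : Psi (_∈ posRange n) (Next (posRange n)) (Together (ω n σ)) (Together τ)) where
  open Reversal n
  open Determinism (reversal n)

  ρ : PERIso (Together (ω n σ)) (Together σ)
  ρ = ωPERIso Vσ

  Vωσ : Valid S (ω n σ)
  Vωσ = ωValid Vσ

  -- `Ψ₂` leads from ω(σ) to τ in the given order, `mirror Ψ₁` from σ to π in the reversed one.
  -- Since ω is an isomorphism between the inputs, `determined`, used in both directions, identifies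
  -- ω(τ) with π.
  returns : ∀ {x y} → Together (ω n τ) x y ⇔ Together π x y
  returns {x} {y} = mk⇔
    (λ q → subst₂ (Together π) (ĉ-involutive x) (ĉ-involutive y)
      (determined Ψ₂ (mirror Ψ₁) nextIso ρ {ĉ x} {ĉ y} (to (ωTogether Vτ) q)))
    (λ q → from (ωTogether Vτ) (determined (mirror Ψ₁) Ψ₂ (invertNext nextIso) (invertPER ρ) {x} {y} q))

  singles : sCount n (ω n σ) ≡ aCount n π
  singles = trans
    (sameLength involutive (Unique.filter⁺ _ (unique-posRange n)) (uniqueLeftPoints S π (unique-posRange n))
      (λ {t} → mk⇔
        (λ m → from (∈-leftPointPairs {S} {π}) (to (proj₁ (exchange Ψ₁) _)
          (relabelSingle ρ (to (Valid.∈-singletonPairs Vωσ) m))))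
        (λ m → from (Valid.∈-singletonPairs Vωσ) (subst (Single (Together (ω n σ))) (involutive t)
          (relabelSingle (invertPER ρ) (from (proj₁ (exchange Ψ₁) _) (to (∈-leftPointPairs {S} {π}) m)))))))
    (length-map proj₁ (adjacencyPairs S π))

  -- As ω reverses the order, left points of ω(σ) correspond to right points of σ, which by
  -- `exchange` are the singletons of π.
  adjacencies : aCount n (ω n σ) ≡ sCount n π
  adjacencies = trans (sym (length-map proj₁ (adjacencyPairs S (ω n σ))))
    (sameLength involutive (uniqueLeftPoints S (ω n σ) (unique-posRange n)) (Unique.filter⁺ _ (unique-posRange n))
      (λ {t} → mk⇔
        (λ m → from (Valid.∈-singletonPairs V) (to (proj₂ (exchange Ψ₁) _)
          (relabelLeft nextIso ρ (to (∈-leftPointPairs {S} {ω n σ}) m))))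
        (λ m → from (∈-leftPointPairs {S} {ω n σ}) (subst (Left (Next S) (Together (ω n σ))) (involutive t)
          (relabelLeft (invertNext nextIso) (invertPER ρ)
            (from (proj₂ (exchange Ψ₁) _) (to (Valid.∈-singletonPairs V) m)))))))

  conclusion : IsV n (ω n σ) × PartEq (ω n τ) π × sCount n (ω n σ) ≡ aCount n π × aCount n (ω n σ) ≡ sCount n π
  conclusion = valid⇒isV Vωσ , sameTogether⇒PartEq (ωValid Vτ) V returns , singles , adjacencies

ψ-realised : ∀ n {π} → Valid (posRange n) π → Valid (posRange n) (ψ n π) ×
  Psi (_∈ posRange n) (Next (posRange n)) (Together π) (Together (ψ n π))
ψ-realised n {π} V = realise (suc n) (posRange n) π (unique-posRange n) V
  -- The fuel n + 1 exceeds by one the number of positive elements.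
  (s≤s (≤-reflexive (length-posRange n)))

theorem3p1 : (n : ℕ) → 1 ≤ n → (π : Partition) → IsV n π →
    IsV n (ω n (ψ n π))
    × PartEq (ω n (ψ n (ω n (ψ n π)))) π
    × sCount n (ω n (ψ n π)) ≡ aCount n π
    × aCount n (ω n (ψ n π)) ≡ sCount n π
theorem3p1 n _ π isV = Involution.conclusion V (proj₁ first) (proj₁ second) (proj₂ first) (proj₂ second)
  where
  V      = isV⇒valid isV
  first  = ψ-realised n V
  second = ψ-realised n (Reversal.ωValid n (proj₁ first))
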